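{- Let $n\ge 2$ be an integer, let $F$ be the discrete Fourier transform matrix of order $n$, and let $C=\mathrm{circ}_n(c_0,c_1,\ldots,c_{n-1})$ be any complex circulant matrix (not necessarily Hermitian) such that $c_0=1$, $|c_j|=1$ for all $j=1,\ldots,n-1$, and $CC^*=nI$. Then the identity matrix $I$, the matrix $F$, and the normalized matrix $\frac{1}{\sqrt n}C$ define a set of three (pairwise) mutually unbiased bases in dimension $n$, the vectors of each basis being the columns of the respective matrix.
   Context: $\mathrm{circ}_n(c_0,c_1,\ldots,c_{n-1})$ denotes the $n\times n$ circulant matrix with first row $(c_0,c_1,\ldots,c_{n-1})$, i.e. with rows and columns indexed by $0,\ldots,n-1$ its $(r,s)$ entry is $c_{(s-r)\bmod n}$. $C^*$ is the conjugate transpose. The discrete Fourier transform matrix of order $n$ is the unitary matrix $F$ with entries $F_{jk}=\frac{1}{\sqrt n}\omega^{jk}$, $j,k=0,\ldots,n-1$, where $\omega=\mathrm{e}^{2\pi\mathrm{i}/n}$. Two orthonormal bases $\{\phi_j\}_{j=0}^{n-1}$ and $\{\psi_k\}_{k=0}^{n-1}$ of $\mathbb{C}^n$ are mutually unbiased if $|\langle\phi_j|\psi_k\rangle|^2=\frac1n$ for all $j,k=0,\ldots,n-1$. A unitary matrix is identified with the orthonormal basis formed by its columns. -}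

module Defs where

open import Algebra.Apartness.Bundles using (HeytingField; HeytingCommutativeRing)
open import Algebra.Bundles using (CommutativeRing)
open import Algebra.Structures using (IsCommutativeRing)
import Algebra.Definitions.RawMonoid as RawMonoidDefs
import Algebra.Apartness.Properties.HeytingCommutativeRing as HeytingProperties
import Algebra.Properties.Monoid.Sum as MonoidSum
import Algebra.Properties.Ring as RingProperties
import Algebra.Properties.Semiring.Exp as SemiringExp
import Algebra.Consequences.Setoid as Consequences
import Algebra.Solver.Ring.NaturalCoefficients.Default as SemiringSolver
open import Data.Fin.Base using (Fin; toℕ)
open import Data.Fin.Properties using (_≟_)
open import Data.List.Base using (List)
open import Data.List.Relation.Unary.All using (All)
open import Data.List.Relation.Unary.AllPairs using (AllPairs)
open import Data.Nat.Base as ℕ using (ℕ; zero; suc; NonZero; _∸_; _!)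
open import Data.Nat.DivMod using (_mod_)
open import Data.Nat.Properties using (_!≢0)
open import Data.Product.Base using (∃-syntax; _×_; _,_; proj₁)
open import Data.Sum.Base using (_⊎_; inj₁; inj₂)
open import Data.Vec.Functional using (Vector)
open import Function.Base using (flip)
open import Level using (_⊔_) renaming (suc to lsuc)
open import Relation.Binary.Core using (Rel)
open import Relation.Binary.Bundles using (Setoid)
open import Relation.Binary.Structures using (IsEquivalence; IsStrictPartialOrder)
open import Relation.Nullary.Decidable using (does)
open import Relation.Nullary.Negation using (¬_; contradiction)
open import Data.Bool.Base using (if_then_else_)

-- The real numbers, axiomatised as a Cauchy complete Archimedean ordered
-- field.  The axioms are constructive: the order need not be decidable.
-- Classically, every model is isomorphic to ℝ.

record RealNumbers c ℓ₁ ℓ₂ ℓ₃ : Set (lsuc (c ⊔ ℓ₁ ⊔ ℓ₂ ⊔ ℓ₃)) where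
  infix 4 _<_
  field
    heytingField : HeytingField c ℓ₁ ℓ₂

  open HeytingField heytingField public

  commutativeRing : CommutativeRing c ℓ₁
  commutativeRing =
    HeytingCommutativeRing.commutativeRing heytingCommutativeRing

  open CommutativeRing commutativeRing public
    using (ring; commutativeSemiring; +-rawMonoid)

  open RawMonoidDefs +-rawMonoid using () renaming (_×_ to _·_)

  fromℕ : ℕ → Carrier
  fromℕ n = n · 1#

  field
    _<_                  : Rel Carrier ℓ₃
    isStrictPartialOrder : IsStrictPartialOrder _≈_ _<_
    <⇒#                  : ∀ {x y} → x < y → x # y
    #⇒<⊎>                : ∀ {x y} → x # y → x < y ⊎ y < x
    +-monoˡ-<            : ∀ {x y} z → x < y → x + z < y + z
    0<x*y                : ∀ {x y} → 0# < x → 0# < y → 0# < x * y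

  field
    archimedean : ∀ x → ∃[ n ] x < fromℕ n

    cauchy-complete :
      ∀ (u : ℕ → Carrier) →
      (∀ ε → 0# < ε → ∃[ N ] ∀ m n → N ℕ.≤ m → N ℕ.≤ n → u m - u n < ε) →
      ∃[ l ] ∀ ε → 0# < ε → ∃[ N ] ∀ m → N ℕ.≤ m →
        (u m - l < ε) × (l - u m < ε)

  infix 4 _≤_

  _≤_ : Rel Carrier ℓ₃
  x ≤ y = ¬ (y < x)

  -- The inverse of a positive number.
  recip : ∀ x → 0# < x → Carrier
  recip x 0<x = proj₁ (#⇒invertible (#-sym (<⇒# 0<x)))

  open IsStrictPartialOrder isStrictPartialOrder public
    using (<-respˡ-≈; <-respʳ-≈)
    renaming (trans to <-trans; irrefl to <-irrefl)

  open RingProperties ring using (-1*x≈-x; -‿involutive)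
  open HeytingProperties heytingCommutativeRing using (1#0)

  0<1 : 0# < 1#
  0<1 with #⇒<⊎> 1#0
  ... | inj₂ 0<1 = 0<1
  ... | inj₁ 1<0 = contradiction (<-trans 1<0 0<1′) (<-irrefl refl)
    where
    0<-1 : 0# < - 1#
    0<-1 = <-respˡ-≈ (-‿inverseʳ 1#)
             (<-respʳ-≈ (+-identityˡ (- 1#)) (+-monoˡ-< (- 1#) 1<0))

    0<1′ : 0# < 1#
    0<1′ = <-respʳ-≈ (trans (-1*x≈-x (- 1#)) (-‿involutive 1#))
             (0<x*y 0<-1 0<-1)

  0<fromℕ : ∀ n .{{_ : NonZero n}} → 0# < fromℕ n
  0<fromℕ (suc zero)      = <-respʳ-≈ (sym (+-identityʳ 1#)) 0<1
  0<fromℕ (suc n@(suc _)) = <-trans (0<fromℕ n)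
    (<-respˡ-≈ (+-identityˡ (fromℕ n)) (+-monoˡ-< (fromℕ n) 0<1))

  1/ : ∀ n .{{_ : NonZero n}} → Carrier
  1/ n = recip (fromℕ n) (0<fromℕ n)

  IsPositiveSqrt : Carrier → Carrier → Set (ℓ₁ ⊔ ℓ₃)
  IsPositiveSqrt x s = (0# < s) × (s * s ≈ x)


module ComplexNumbers {c ℓ₁ ℓ₂ ℓ₃} (R : RealNumbers c ℓ₁ ℓ₂ ℓ₃) where

  private
    module ℝ = RealNumbers R
    open ℝ using (0#; 1#)
      renaming (Carrier to ℝ; _+_ to _+ʳ_; _*_ to _*ʳ_; -_ to -ʳ_; _-_ to _-ʳ_)

  infix 5 _+i_

  record ℂ : Set c where
    constructor _+i_
    field
      re : ℝ
      im : ℝ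

  open ℂ public

  infix 4 _≈_

  record _≈_ (z w : ℂ) : Set ℓ₁ where
    constructor _,_
    field
      re≈ : re z ℝ.≈ re w
      im≈ : im z ℝ.≈ im w

  infixl 7 _*_
  infixl 6 _+_
  infix  8 -_

  _+_ : ℂ → ℂ → ℂ
  (a +i b) + (x +i y) = (a +ʳ x) +i (b +ʳ y)

  _*_ : ℂ → ℂ → ℂ
  (a +i b) * (x +i y) = (a *ʳ x -ʳ b *ʳ y) +i (a *ʳ y +ʳ b *ʳ x)

  -_ : ℂ → ℂ
  - (a +i b) = (-ʳ a) +i (-ʳ b)

  fromℝ : ℝ → ℂ
  fromℝ x = x +i 0#

  0ℂ 1ℂ 𝕚 : ℂ
  0ℂ = fromℝ 0#
  1ℂ = fromℝ 1#
  𝕚  = 0# +i 1#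

  conj : ℂ → ℂ
  conj (a +i b) = a +i (-ʳ b)

  infix 9 ∣_∣²

  ∣_∣² : ℂ → ℝ
  ∣ a +i b ∣² = a *ʳ a +ʳ b *ʳ b

  -- HasModulus z r says that r is the nonnegative square root of ∣ z ∣².
  HasModulus : ℂ → ℝ → Set (ℓ₁ ⊔ ℓ₃)
  HasModulus z r = (0# ℝ.≤ r) × (r *ʳ r ℝ.≈ ∣ z ∣²)

  private
    open RingProperties ℝ.ring using (-1*x≈-x)
    open SemiringSolver ℝ.commutativeSemiring using (solve; _:=_; _:+_; _:*_)

    -- Negation becomes multiplication by the constant -1, an atom for the
    -- semiring solver.
    -1ʳ : ℝ
    -1ʳ = -ʳ 1#

    x-y≈x+-1*y : ∀ {x x′ y y′} → x ℝ.≈ x′ → y ℝ.≈ y′ →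
                 x -ʳ y ℝ.≈ x′ +ʳ -1ʳ *ʳ y′
    x-y≈x+-1*y x≈x′ y≈y′ = ℝ.+-cong x≈x′
      (ℝ.trans (ℝ.-‿cong y≈y′) (ℝ.sym (-1*x≈-x _)))

    *-cong : ∀ {z z′ w w′} → z ≈ z′ → w ≈ w′ → z * w ≈ z′ * w′
    *-cong (a , b) (x , y) =
      ℝ.+-cong (ℝ.*-cong a x) (ℝ.-‿cong (ℝ.*-cong b y)) ,
      ℝ.+-cong (ℝ.*-cong a y) (ℝ.*-cong b x)

    *-comm : ∀ z w → z * w ≈ w * z
    *-comm (a +i b) (x +i y) =
      ℝ.+-cong (ℝ.*-comm a x) (ℝ.-‿cong (ℝ.*-comm b y)) ,
      ℝ.trans (ℝ.+-comm _ _) (ℝ.+-cong (ℝ.*-comm b x) (ℝ.*-comm a y))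

    *-assoc : ∀ z w v → (z * w) * v ≈ z * (w * v)
    *-assoc (a +i b) (x +i y) (u +i v) =
      ℝ.trans (x-y≈x+-1*y (ℝ.*-congʳ (x-y≈x+-1*y ℝ.refl ℝ.refl)) ℝ.refl)
        (ℝ.trans
          (solve 7 (λ a b x y u v m →
            (a :* x :+ m :* (b :* y)) :* u :+ m :* ((a :* y :+ b :* x) :* v) :=
            a :* (x :* u :+ m :* (y :* v)) :+ m :* (b :* (x :* v :+ y :* u)))
            ℝ.refl a b x y u v -1ʳ)
          (ℝ.sym (x-y≈x+-1*y (ℝ.*-congˡ (x-y≈x+-1*y ℝ.refl ℝ.refl)) ℝ.refl))) ,
      ℝ.trans (ℝ.+-congʳ (ℝ.*-congʳ (x-y≈x+-1*y ℝ.refl ℝ.refl)))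
        (ℝ.trans
          (solve 7 (λ a b x y u v m →
            (a :* x :+ m :* (b :* y)) :* v :+ (a :* y :+ b :* x) :* u :=
            a :* (x :* v :+ y :* u) :+ b :* (x :* u :+ m :* (y :* v)))
            ℝ.refl a b x y u v -1ʳ)
          (ℝ.sym (ℝ.+-congˡ (ℝ.*-congˡ (x-y≈x+-1*y ℝ.refl ℝ.refl)))))

    *-identityˡ : ∀ z → 1ℂ * z ≈ z
    *-identityˡ (a +i b) =
      ℝ.trans (x-y≈x+-1*y (ℝ.*-identityˡ a) (ℝ.zeroˡ b))
        (ℝ.trans (ℝ.+-congˡ (ℝ.zeroʳ _)) (ℝ.+-identityʳ a)) ,
      ℝ.trans (ℝ.+-cong (ℝ.*-identityˡ b) (ℝ.zeroˡ a)) (ℝ.+-identityʳ b)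

    *-distribˡ-+ : ∀ z w v → z * (w + v) ≈ z * w + z * v
    *-distribˡ-+ (a +i b) (x +i y) (u +i v) =
      ℝ.trans (x-y≈x+-1*y ℝ.refl ℝ.refl)
        (ℝ.trans
          (solve 7 (λ a b x y u v m →
            a :* (x :+ u) :+ m :* (b :* (y :+ v)) :=
            (a :* x :+ m :* (b :* y)) :+ (a :* u :+ m :* (b :* v)))
            ℝ.refl a b x y u v -1ʳ)
          (ℝ.sym (ℝ.+-cong (x-y≈x+-1*y ℝ.refl ℝ.refl)
                           (x-y≈x+-1*y ℝ.refl ℝ.refl)))) ,
      solve 6 (λ a b x y u v →
        a :* (y :+ v) :+ b :* (x :+ u) :=
        (a :* y :+ b :* x) :+ (a :* v :+ b :* u))
        ℝ.refl a b x y u v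

    isEquivalence : IsEquivalence _≈_
    isEquivalence = record
      { refl  = ℝ.refl , ℝ.refl
      ; sym   = λ { (p , q) → ℝ.sym p , ℝ.sym q }
      ; trans = λ { (p , q) (p′ , q′) → ℝ.trans p p′ , ℝ.trans q q′ }
      }

    setoid : Setoid c ℓ₁
    setoid = record { isEquivalence = isEquivalence }

    open Consequences setoid using (comm∧idˡ⇒id; comm∧distrˡ⇒distr)

  +-*-isCommutativeRing : IsCommutativeRing _≈_ _+_ _*_ -_ 0ℂ 1ℂ
  +-*-isCommutativeRing = record
    { isRing = record
      { +-isAbelianGroup = record
        { isGroup = record
          { isMonoid = record
            { isSemigroup = record
              { isMagma = record
                { isEquivalence = isEquivalence
                ; ∙-cong = λ { (p , q) (p′ , q′) →
                    ℝ.+-cong p p′ , ℝ.+-cong q q′ }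
                }
              ; assoc = λ _ _ _ → ℝ.+-assoc _ _ _ , ℝ.+-assoc _ _ _
              }
            ; identity = (λ _ → ℝ.+-identityˡ _ , ℝ.+-identityˡ _)
                       , (λ _ → ℝ.+-identityʳ _ , ℝ.+-identityʳ _)
            }
          ; inverse = (λ _ → ℝ.-‿inverseˡ _ , ℝ.-‿inverseˡ _)
                    , (λ _ → ℝ.-‿inverseʳ _ , ℝ.-‿inverseʳ _)
          ; ⁻¹-cong = λ { (p , q) → ℝ.-‿cong p , ℝ.-‿cong q }
          }
        ; comm = λ _ _ → ℝ.+-comm _ _ , ℝ.+-comm _ _
        }
      ; *-cong     = *-cong
      ; *-assoc    = *-assoc
      ; *-identity = comm∧idˡ⇒id *-comm *-identityˡ
      ; distrib    = comm∧distrˡ⇒distr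
          (λ { (p , q) (p′ , q′) → ℝ.+-cong p p′ , ℝ.+-cong q q′ })
          *-comm *-distribˡ-+
      }
    ; *-comm = *-comm
    }

  +-*-commutativeRing : CommutativeRing c ℓ₁
  +-*-commutativeRing = record { isCommutativeRing = +-*-isCommutativeRing }

  open CommutativeRing +-*-commutativeRing public
    using (_-_; +-monoid; semiring)

  open MonoidSum +-monoid public using (sum-syntax)
  open SemiringExp semiring public using (_^_)

  -- ∣ z m - l ∣ < ε, with both sides squared.
  _⟶_ : (ℕ → ℂ) → ℂ → Set (c ⊔ ℓ₃)
  z ⟶ l = ∀ ε → 0# ℝ.< ε → ∃[ N ] ∀ m → N ℕ.≤ m →
    ∣ z m - l ∣² ℝ.< ε *ʳ ε

  -- IsExp z w says that w is the sum of the exponential series at z.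
  IsExp : ℂ → ℂ → Set (c ⊔ ℓ₃)
  IsExp z w = (λ m → ∑[ k < m ] (fromℝ (1/! (toℕ k)) * z ^ toℕ k)) ⟶ w
    where
    1/! : ℕ → ℝ
    1/! k = ℝ.1/ (k !) {{ k !≢0 }}

  -- sin x = im e^(ix).
  SinZero : ℝ → Set (c ⊔ ℓ₁ ⊔ ℓ₃)
  SinZero x = ∃[ w ] IsExp (𝕚 * fromℝ x) w × (im w ℝ.≈ 0#)

  -- π is the least positive zero of sine.
  IsPi : ℝ → Set (c ⊔ ℓ₁ ⊔ ℓ₃)
  IsPi π = (0# ℝ.< π) × SinZero π ×
           (∀ x → 0# ℝ.< x → x ℝ.< π → ¬ SinZero x)


module Bases {c ℓ₁ ℓ₂ ℓ₃} (R : RealNumbers c ℓ₁ ℓ₂ ℓ₃) where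

  private module ℝ = RealNumbers R
  open ComplexNumbers R

  Matrix : ℕ → ℕ → Set c
  Matrix m n = Fin m → Fin n → ℂ

  infix 4 _≋_

  _≋_ : ∀ {m n} → Matrix m n → Matrix m n → Set ℓ₁
  A ≋ B = ∀ i j → A i j ≈ B i j

  infixl 7 _⊗_
  infixr 8 _•_
  infix  9 _†

  _⊗_ : ∀ {l m n} → Matrix l m → Matrix m n → Matrix l n
  _⊗_ {m = m} A B i j = ∑[ k < m ] (A i k * B k j)

  _†  : ∀ {m n} → Matrix m n → Matrix n m
  (A †) i j = conj (A j i)

  _•_ : ∀ {m n} → ℝ.Carrier → Matrix m n → Matrix m n
  (x • A) i j = fromℝ x * A i j

  identity : ∀ n → Matrix n n
  identity n i j = if does (i ≟ j) then 1ℂ else 0ℂ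

  -- r < n, so toℕ s + (n ∸ toℕ r) represents s - r modulo n.
  circ : ∀ n .{{_ : NonZero n}} → Vector ℂ n → Matrix n n
  circ n c r s = c ((toℕ s ℕ.+ (n ∸ toℕ r)) mod n)

  -- The discrete Fourier transform matrix, from √n and ω = e^(2πi/n).
  dft : ∀ n (√n : ℝ.Carrier) → ℝ.0# ℝ.< √n → ℂ → Matrix n n
  dft n √n 0<√n ω = ℝ.recip √n 0<√n • λ j k → ω ^ (toℕ j ℕ.* toℕ k)

  Family : ℕ → ℕ → Set c
  Family m n = Fin m → Vector ℂ n

  columns : ∀ {m n} → Matrix m n → Family n m
  columns = flip

  ⟨_∣_⟩ : ∀ {n} → Vector ℂ n → Vector ℂ n → ℂ
  ⟨_∣_⟩ {n} u v = ∑[ i < n ] (conj (u i) * v i)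

  combination : ∀ {m n} → Vector ℂ m → Family m n → Vector ℂ n
  combination {m} a φ i = ∑[ j < m ] (a j * φ j i)

  LinearlyIndependent : ∀ {m n} → Family m n → Set (c ⊔ ℓ₁)
  LinearlyIndependent φ =
    ∀ a → (∀ i → combination a φ i ≈ 0ℂ) → ∀ j → a j ≈ 0ℂ

  Spanning : ∀ {m n} → Family m n → Set (c ⊔ ℓ₁)
  Spanning {n = n} φ =
    ∀ (v : Vector ℂ n) → ∃[ a ] ∀ i → combination a φ i ≈ v i

  Orthonormal : ∀ {m n} → Family m n → Set ℓ₁
  Orthonormal {m} φ = ∀ j k → ⟨ φ j ∣ φ k ⟩ ≈ identity m j k

  IsOrthonormalBasis : ∀ {n} → Family n n → Set (c ⊔ ℓ₁)
  IsOrthonormalBasis φ =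
    LinearlyIndependent φ × Spanning φ × Orthonormal φ

  Unbiased : ∀ {n} .{{_ : NonZero n}} → Family n n → Family n n → Set ℓ₁
  Unbiased {n} φ ψ = ∀ j k → ∣ ⟨ φ j ∣ ψ k ⟩ ∣² ℝ.≈ ℝ.1/ n

  MutuallyUnbiasedBases : ∀ {n} .{{_ : NonZero n}} →
                          List (Family n n) → Set (c ⊔ ℓ₁)
  MutuallyUnbiasedBases Φ = All IsOrthonormalBasis Φ × AllPairs Unbiased Φ

{-# OPTIONS --safe #-}
module Submission where

-- Geometric convergence of the partial sums of the exponential series turns
-- the Cauchy product into exp (z + w) = exp z · exp w.  Hence ω has modulus 1,
-- ωⁿ = (e^(iπ))² = 1, and ωᵏ = (e^(iπk/n))² ≠ 1 for 0 < k < n because sine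
-- does not vanish below π; this makes F unitary.  Reflecting indices modulo n
-- turns C C† = n I into C† C = n I, and it shows that the inner products of the
-- j-th Fourier vector with the columns of C are, up to unimodular factors, all
-- equal to one eigenvalue of C.  By C C† = n I that eigenvalue has squared
-- modulus n, so F and C are unbiased.

open import Defs
open import Algebra.Bundles using (CommutativeRing)
import Algebra.Properties.AbelianGroup as AbelianGroupProperties
import Algebra.Properties.CommutativeSemigroup as CommutativeSemigroupProperties
import Algebra.Properties.CommutativeSemiring.Exp as CommutativeSemiringExp
import Algebra.Properties.Monoid.Sum as MonoidSum
import Algebra.Properties.Ring as RingProperties
import Algebra.Properties.Semiring.Exp as SemiringExp
import Algebra.Properties.Semiring.Mult as SemiringMult
import Algebra.Properties.Semiring.Mult.TCOptimised as SemiringMultTCOptimised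
import Algebra.Properties.Semiring.Sum as SemiringSum
import Algebra.Solver.Ring as RingSolver
open import Algebra.Solver.Ring.AlmostCommutativeRing using (_-Raw-AlmostCommutative⟶_; fromCommutativeRing)
open import Data.Bool.Base using (if_then_else_)
open import Data.Fin.Base as Fin using (Fin; zero; suc; toℕ)
open import Data.Fin.Permutation using (Permutation; permutation)
import Data.Fin.Properties as Fin
open import Data.Integer.Base as ℤ using (ℤ; +_; -[1+_])
import Data.Integer.Properties as ℤ
open import Data.List.Base using ([]; _∷_; map)
open import Data.List.Relation.Unary.All as All using ()
open import Data.List.Relation.Unary.AllPairs as AllPairs using ()
open import Data.Maybe.Base using (Maybe; just; nothing)
open import Data.Nat.Base as ℕ using (ℕ; zero; suc; NonZero; _∸_; _!)
open import Data.Nat.DivMod using (_%_; _/_; _mod_; %-distribˡ-+; [m+n]%n≡m%n; m%n%n≡m%n; m%n<n; m<n⇒m%n≡m; m≡m%n+[m/n]*n)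
import Data.Nat.Properties as ℕ
open import Data.Product.Base using (_,_; _×_; ∃-syntax; proj₁; proj₂)
open import Data.Sum.Base using (_⊎_; inj₁; inj₂)
open import Data.Vec.Functional using (Vector)
open import Function.Base using (_∘_)
open import Level using (_⊔_)
open import Relation.Binary.Definitions using (tri<; tri≈; tri>)
open import Relation.Binary.PropositionalEquality.Core as ≡ using (_≡_; _≢_)
open import Relation.Binary.PropositionalEquality.Properties using (module ≡-Reasoning)
import Relation.Binary.Reasoning.Base.Triple as TripleReasoning
import Relation.Binary.Reasoning.Setoid as SetoidReasoning
open import Relation.Binary.Structures using (IsPreorder; IsStrictPartialOrder)
open import Relation.Nullary.Decidable.Core using (does; yes; no)
open import Relation.Nullary.Negation using (¬_; contradiction)

-- The reals are axiomatised constructively, so neither order nor equality can be decided, and this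
-- shapes most of the proof. Equality is stable under double negation because apartness is tight;
-- that suffices to cancel a factor `z` of a product in ℂ given only `¬ (z ≈ 0ℂ)`. The linear
-- algebra, carried out over an abstract commutative ring, takes this cancellation law as a
-- parameter. Moduli are bounded through their squares, and limits are handled by errors of the form
-- K ½ⁿ. The minimality of π refutes only those zeros of sine that come with a value of e^(ix), so
-- such values have to be constructed; this is where Cauchy completeness enters. C is never
-- diagonalised: since the n inner products of one Fourier vector with the columns of C have equal
-- squared moduli, the sum of these squares determines each of them.

module IntegerCoefficients {c ℓ} (R : CommutativeRing c ℓ) where

  open CommutativeRing R
  open RingProperties ring using (-0#≈0#; -‿involutive; -‿distribˡ-*; -‿distribʳ-*)
  open AbelianGroupProperties +-abelianGroup using (⁻¹-∙-comm)
  open SemiringMultTCOptimised semiring using (1+×; ×-homo-+; ×1-homo-*) renaming (_×_ to _·_)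
  open SetoidReasoning setoid

  fromℤ : ℤ → Carrier
  fromℤ (+ n)      = n · 1#
  fromℤ (-[1+ n ]) = - (suc n · 1#)

  [1+x]-[1+y]≈x-y : ∀ x y → (1# + x) - (1# + y) ≈ x - y
  [1+x]-[1+y]≈x-y x y = begin
    (1# + x) - (1# + y)       ≈⟨ +-cong (+-comm x 1#) (⁻¹-∙-comm 1# y) ⟨
    (x + 1#) + (- 1# - y)     ≈⟨ +-assoc x 1# _ ⟩
    x + (1# + (- 1# - y))     ≈⟨ +-congˡ (+-assoc 1# (- 1#) (- y)) ⟨
    x + ((1# - 1#) - y)       ≈⟨ +-congˡ (+-congʳ (-‿inverseʳ 1#)) ⟩
    x + (0# - y)              ≈⟨ +-congˡ (+-identityˡ (- y)) ⟩
    x - y                     ∎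

  fromℤ-⊖ : ∀ m n → fromℤ (m ℤ.⊖ n) ≈ m · 1# - n · 1#
  fromℤ-⊖ m       zero    = sym (trans (+-congˡ -0#≈0#) (+-identityʳ _))
  fromℤ-⊖ zero    (suc n) = sym (+-identityˡ _)
  fromℤ-⊖ (suc m) (suc n) = begin
    fromℤ (suc m ℤ.⊖ suc n)              ≡⟨ ≡.cong fromℤ (ℤ.[1+m]⊖[1+n]≡m⊖n m n) ⟩
    fromℤ (m ℤ.⊖ n)                      ≈⟨ fromℤ-⊖ m n ⟩
    m · 1# - n · 1#                      ≈⟨ [1+x]-[1+y]≈x-y _ _ ⟨
    (1# + m · 1#) - (1# + n · 1#)        ≈⟨ +-cong (1+× m 1#) (-‿cong (1+× n 1#)) ⟨
    suc m · 1# - suc n · 1#              ∎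

  fromℤ-neg : ∀ i → fromℤ (ℤ.- i) ≈ - fromℤ i
  fromℤ-neg -[1+ n ]    = sym (-‿involutive _)
  fromℤ-neg (+ zero)    = sym -0#≈0#
  fromℤ-neg (+ (suc n)) = refl

  fromℤ-+ : ∀ i j → fromℤ (i ℤ.+ j) ≈ fromℤ i + fromℤ j
  fromℤ-+ (+ m)    (+ n)    = ×-homo-+ 1# m n
  fromℤ-+ (+ m)    -[1+ n ] = fromℤ-⊖ m (suc n)
  fromℤ-+ -[1+ m ] (+ n)    = trans (fromℤ-⊖ n (suc m)) (+-comm _ _)
  fromℤ-+ -[1+ m ] -[1+ n ] = begin
    - (suc (suc (m ℕ.+ n)) · 1#)      ≡⟨ ≡.cong (λ k → - (k · 1#)) (ℕ.+-suc (suc m) n) ⟨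
    - ((suc m ℕ.+ suc n) · 1#)        ≈⟨ -‿cong (×-homo-+ 1# (suc m) (suc n)) ⟩
    - (suc m · 1# + suc n · 1#)       ≈⟨ ⁻¹-∙-comm _ _ ⟨
    - (suc m · 1#) - (suc n · 1#)     ∎

  fromℤ-ℕ*ℕ : ∀ m n → fromℤ (+ m ℤ.* + n) ≈ fromℤ (+ m) * fromℤ (+ n)
  fromℤ-ℕ*ℕ m n = trans (reflexive (≡.cong fromℤ (≡.sym (ℤ.pos-* m n)))) (×1-homo-* m n)

  fromℤ-ℕ* : ∀ m j → fromℤ (+ m ℤ.* j) ≈ fromℤ (+ m) * fromℤ j
  fromℤ-ℕ* m (+ n)    = fromℤ-ℕ*ℕ m n
  fromℤ-ℕ* m -[1+ n ] = begin
    fromℤ (+ m ℤ.* ℤ.- (+ suc n))     ≡⟨ ≡.cong fromℤ (ℤ.neg-distribʳ-* (+ m) (+ suc n)) ⟨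
    fromℤ (ℤ.- (+ m ℤ.* + suc n))     ≈⟨ fromℤ-neg (+ m ℤ.* + suc n) ⟩
    - fromℤ (+ m ℤ.* + suc n)         ≈⟨ -‿cong (fromℤ-ℕ*ℕ m (suc n)) ⟩
    - ((m · 1#) * (suc n · 1#))       ≈⟨ -‿distribʳ-* _ _ ⟩
    (m · 1#) * - (suc n · 1#)         ∎

  fromℤ-* : ∀ i j → fromℤ (i ℤ.* j) ≈ fromℤ i * fromℤ j
  fromℤ-* (+ m)    j = fromℤ-ℕ* m j
  fromℤ-* -[1+ m ] j = begin
    fromℤ (ℤ.- (+ suc m) ℤ.* j)       ≡⟨ ≡.cong fromℤ (ℤ.neg-distribˡ-* (+ suc m) j) ⟨
    fromℤ (ℤ.- (+ suc m ℤ.* j))       ≈⟨ fromℤ-neg (+ suc m ℤ.* j) ⟩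
    - fromℤ (+ suc m ℤ.* j)           ≈⟨ -‿cong (fromℤ-ℕ* (suc m) j) ⟩
    - ((suc m · 1#) * fromℤ j)        ≈⟨ -‿distribˡ-* _ _ ⟩
    - (suc m · 1#) * fromℤ j          ∎

  -- Coefficients from ℤ have decidable equality although the carrier has none, so that the solver
  -- can cancel terms such as x - x in normal forms.
  fromℤ-homomorphism : ℤ.+-*-rawRing -Raw-AlmostCommutative⟶ fromCommutativeRing R
  fromℤ-homomorphism = record
    { ⟦_⟧    = fromℤ
    ; +-homo = fromℤ-+
    ; *-homo = fromℤ-*
    ; -‿homo = fromℤ-neg
    ; 0-homo = refl
    ; 1-homo = refl
    }

  fromℤ≟ : ∀ i j → Maybe (fromℤ i ≈ fromℤ j)
  fromℤ≟ i j with i ℤ.≟ j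
  ... | yes i≡j = just (reflexive (≡.cong fromℤ i≡j))
  ... | no  _   = nothing

  open RingSolver ℤ.+-*-rawRing (fromCommutativeRing R) fromℤ-homomorphism fromℤ≟ public

  :1 : ∀ {n} → Polynomial n
  :1 = con (+ 1)

  :0 : ∀ {n} → Polynomial n
  :0 = con (+ 0)

-- Finite sums over ℕ, the Cauchy product and the recurrence of the exponential series

module Sequences {c ℓ} (R : CommutativeRing c ℓ) where

  open CommutativeRing R
  open MonoidSum +-monoid using (sum-syntax; sum-init-last; sum-cong-≗)
  open SemiringMult semiring using (×-homo-+) renaming (_×_ to _·_)
  open IntegerCoefficients R using (solve; _:=_; _:+_; _:-_; _:*_; :-_; :0; :1)
  open SetoidReasoning setoid

  -- Peeling off the last summand suits partial sums of a series; sums over `Fin` peel off the first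
  -- one, and `∑≈Σ<` mediates.
  Σ< : (ℕ → Carrier) → ℕ → Carrier
  Σ< f zero    = 0#
  Σ< f (suc n) = Σ< f n + f n

  Σ<-cong : ∀ {f g} n → (∀ {k} → k ℕ.< n → f k ≈ g k) → Σ< f n ≈ Σ< g n
  Σ<-cong zero    f≈g = refl
  Σ<-cong (suc n) f≈g = +-cong (Σ<-cong n (f≈g ∘ ℕ.m<n⇒m<1+n)) (f≈g ℕ.≤-refl)

  Σ<-+ : ∀ f g n → Σ< (λ k → f k + g k) n ≈ Σ< f n + Σ< g n
  Σ<-+ f g zero    = sym (+-identityˡ 0#)
  Σ<-+ f g (suc n) = trans (+-congʳ (Σ<-+ f g n))
    (solve 4 (λ a b x y → a :+ b :+ (x :+ y) := a :+ x :+ (b :+ y)) refl _ _ _ _)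

  Σ<-distribˡ : ∀ x f n → x * Σ< f n ≈ Σ< (λ k → x * f k) n
  Σ<-distribˡ x f zero    = zeroʳ x
  Σ<-distribˡ x f (suc n) = trans (distribˡ _ _ _) (+-congʳ (Σ<-distribˡ x f n))

  Σ<-head : ∀ f n → Σ< f (suc n) ≈ f 0 + Σ< (f ∘ suc) n
  Σ<-head f zero    = +-comm 0# (f 0)
  Σ<-head f (suc n) = trans (+-congʳ (Σ<-head f n)) (+-assoc _ _ _)

  ∑≈Σ< : ∀ f n → ∑[ k < n ] f (toℕ k) ≈ Σ< f n
  ∑≈Σ< f zero    = refl
  ∑≈Σ< f (suc n) = begin
    ∑[ k < suc n ] f (toℕ k)
      ≈⟨ sum-init-last {n} (f ∘ toℕ) ⟩
    ∑[ k < n ] f (toℕ (Fin.inject₁ k)) + f (toℕ (Fin.fromℕ n))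
      ≡⟨ ≡.cong₂ _+_ (sum-cong-≗ {n} (≡.cong f ∘ Fin.toℕ-inject₁)) (≡.cong f (Fin.toℕ-fromℕ n)) ⟩
    ∑[ k < n ] f (toℕ k) + f n
      ≈⟨ +-congʳ (∑≈Σ< f n) ⟩
    Σ< f (suc n) ∎

  infixl 7 _⊛_

  _⊛_ : (ℕ → Carrier) → (ℕ → Carrier) → ℕ → Carrier
  (f ⊛ g) n = Σ< (λ k → f k * g (n ∸ k)) (suc n)

  -- The triangle of pairs with k + l < n is summed by diagonals on the left and by rows on the
  -- right. Raising n by one lengthens each row by one entry, and these entries form the new
  -- diagonal.
  Σ<-⊛ : ∀ f g n → Σ< (f ⊛ g) n ≈ Σ< (λ k → f k * Σ< g (n ∸ k)) n
  Σ<-⊛ f g zero    = refl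
  Σ<-⊛ f g (suc n) = begin
    Σ< (f ⊛ g) n + (f ⊛ g) n
      ≈⟨ +-congʳ (Σ<-⊛ f g n) ⟩
    Σ< (λ k → f k * Σ< g (n ∸ k)) n + (f ⊛ g) n
      ≈⟨ +-congʳ (+-identityʳ _) ⟨
    -- The row k = n is still empty; adding it lets all rows up to n be extended at once.
    Σ< (λ k → f k * Σ< g (n ∸ k)) n + 0# + (f ⊛ g) n
      ≈⟨ +-congʳ (+-congˡ fₙ*0≈0) ⟨
    Σ< (λ k → f k * Σ< g (n ∸ k)) (suc n) + (f ⊛ g) n
      ≈⟨ Σ<-+ _ _ (suc n) ⟨
    Σ< (λ k → f k * Σ< g (n ∸ k) + f k * g (n ∸ k)) (suc n)
      ≈⟨ Σ<-cong (suc n) (λ { {k} (ℕ.s≤s k≤n) → trans (sym (distribˡ _ _ _))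
           (reflexive (≡.cong (λ i → f k * Σ< g i) (≡.sym (ℕ.+-∸-assoc 1 k≤n)))) }) ⟩
    Σ< (λ k → f k * Σ< g (suc n ∸ k)) (suc n) ∎
    where
    fₙ*0≈0 : f n * Σ< g (n ∸ n) ≈ 0#
    fₙ*0≈0 = trans (reflexive (≡.cong (λ i → f n * Σ< g i) (ℕ.n∸n≡0 n))) (zeroʳ (f n))

  -- The square of pairs minus the triangle leaves in row k a segment at the end of the sum of `g`.
  -- In this form bounds on the tails of `g` apply.
  Σ<*Σ<-Σ<⊛ : ∀ f g n → Σ< f n * Σ< g n - Σ< (f ⊛ g) n ≈
              Σ< (λ k → f k * (Σ< g n - Σ< g (n ∸ k))) n
  Σ<*Σ<-Σ<⊛ f g n = begin
    Σ< f n * Σ< g n - Σ< (f ⊛ g) n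
      ≈⟨ +-cong (trans (*-comm _ _) (Σ<-distribˡ _ f n))
           (trans (-‿cong (Σ<-⊛ f g n)) (trans (solve 1 (λ x → :- x := :- :1 :* x) refl _) (Σ<-distribˡ (- 1#) _ n))) ⟩
    Σ< (λ k → Σ< g n * f k) n + Σ< (λ k → - 1# * (f k * Σ< g (n ∸ k))) n
      ≈⟨ Σ<-+ _ _ n ⟨
    Σ< (λ k → Σ< g n * f k + - 1# * (f k * Σ< g (n ∸ k))) n
      ≈⟨ Σ<-cong n (λ _ → solve 3 (λ a b x → b :* a :+ :- :1 :* (a :* x) := a :* (b :- x)) refl _ _ _) ⟩
    Σ< (λ k → f k * (Σ< g n - Σ< g (n ∸ k))) n ∎

  -- The recurrence characterising f k = x ^ k / k !, free of division.
  IsExpTerms : Carrier → (ℕ → Carrier) → Set ℓ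
  IsExpTerms x f = ∀ k → (suc k · 1#) * f (suc k) ≈ x * f k

  -- In terms of the generating series F, the recurrence reads F′ = x F, so this is the Leibniz rule
  -- (F G)′ = F′ G + F G′. It appears as the splitting n + 1 = k + (n + 1 - k) of the weight of each
  -- term.
  ⊛-isExpTerms : ∀ {x y f g} → IsExpTerms x f → IsExpTerms y g → IsExpTerms (x + y) (f ⊛ g)
  ⊛-isExpTerms {x} {y} {f} {g} fᵉ gᵉ n = begin
    ν (suc n) * (f ⊛ g) (suc n)
      ≈⟨ Σ<-distribˡ _ _ (suc (suc n)) ⟩
    Σ< (λ k → ν (suc n) * (f k * g (suc n ∸ k))) (suc (suc n))
      ≈⟨ Σ<-cong (suc (suc n)) (λ { {k} (ℕ.s≤s k≤1+n) → split k k≤1+n }) ⟩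
    Σ< (λ k → ν k * f k * g (suc n ∸ k) + f k * (ν (suc n ∸ k) * g (suc n ∸ k))) (suc (suc n))
      ≈⟨ Σ<-+ _ _ (suc (suc n)) ⟩
    Σ< (λ k → ν k * f k * g (suc n ∸ k)) (suc (suc n)) +
    Σ< (λ k → f k * (ν (suc n ∸ k) * g (suc n ∸ k))) (suc (suc n))
      -- The weight vanishes at k = 0 in one sum and at k = n + 1 in the other; dropping these terms
      -- leaves two sums over the same range.
      ≈⟨ +-cong (Σ<-head _ (suc n)) (+-congˡ last≈0) ⟩
    (0# * f 0 * g (suc n) + Σ< (λ k → ν (suc k) * f (suc k) * g (n ∸ k)) (suc n)) +
    (Σ< (λ k → f k * (ν (suc n ∸ k) * g (suc n ∸ k))) (suc n) + 0#)
      ≈⟨ +-cong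
           (+-cong (trans (*-congʳ (zeroˡ _)) (zeroˡ _))
             (Σ<-cong (suc n) (λ {k} _ → trans (*-congʳ (fᵉ k)) (*-assoc _ _ _))))
           (+-congʳ (Σ<-cong (suc n) (λ { {k} (ℕ.s≤s k≤n) → step k k≤n }))) ⟩
    (0# + Σ< (λ k → x * (f k * g (n ∸ k))) (suc n)) +
    (Σ< (λ k → y * (f k * g (n ∸ k))) (suc n) + 0#)
      ≈⟨ +-cong (+-congˡ (Σ<-distribˡ x _ (suc n))) (+-congʳ (Σ<-distribˡ y _ (suc n))) ⟨
    (0# + x * (f ⊛ g) n) + (y * (f ⊛ g) n + 0#)
      ≈⟨ solve 3 (λ x y w → :0 :+ x :* w :+ (y :* w :+ :0) := (x :+ y) :* w) refl x y ((f ⊛ g) n) ⟩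
    (x + y) * (f ⊛ g) n ∎
    where
    ν : ℕ → Carrier
    ν k = k · 1#

    split : ∀ k → k ℕ.≤ suc n → ν (suc n) * (f k * g (suc n ∸ k)) ≈
            ν k * f k * g (suc n ∸ k) + f k * (ν (suc n ∸ k) * g (suc n ∸ k))
    split k k≤1+n = trans
      (*-congʳ (trans (reflexive (≡.cong ν (≡.sym (ℕ.m+[n∸m]≡n k≤1+n)))) (×-homo-+ 1# k (suc n ∸ k))))
      (solve 4 (λ a b u v → (a :+ b) :* (u :* v) := a :* u :* v :+ u :* (b :* v)) refl _ _ _ _)

    last≈0 : f (suc n) * (ν (suc n ∸ suc n) * g (suc n ∸ suc n)) ≈ 0#
    last≈0 = trans (*-congˡ (trans (*-congʳ (reflexive (≡.cong ν (ℕ.n∸n≡0 (suc n))))) (zeroˡ _))) (zeroʳ _)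

    step : ∀ k → k ℕ.≤ n → f k * (ν (suc n ∸ k) * g (suc n ∸ k)) ≈ y * (f k * g (n ∸ k))
    step k k≤n = begin
      f k * (ν (suc n ∸ k) * g (suc n ∸ k))       ≡⟨ ≡.cong (λ i → f k * (ν i * g i)) (ℕ.+-∸-assoc 1 k≤n) ⟩
      f k * (ν (suc (n ∸ k)) * g (suc (n ∸ k)))   ≈⟨ *-congˡ (gᵉ (n ∸ k)) ⟩
      f k * (y * g (n ∸ k))                       ≈⟨ solve 3 (λ a b d → a :* (b :* d) := b :* (a :* d)) refl _ _ _ ⟩
      y * (f k * g (n ∸ k))                       ∎

-- Residues modulo n and the reflections k ↦ t - k

module _ (n : ℕ) .{{_ : NonZero n}} where

  %-+-congˡ : ∀ {a b} k → a % n ≡ b % n → (a ℕ.+ k) % n ≡ (b ℕ.+ k) % n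
  %-+-congˡ {a} {b} k a≡b = begin
    (a ℕ.+ k) % n          ≡⟨ %-distribˡ-+ a k n ⟩
    (a % n ℕ.+ k % n) % n  ≡⟨ ≡.cong (λ r → (r ℕ.+ k % n) % n) a≡b ⟩
    (b % n ℕ.+ k % n) % n  ≡⟨ %-distribˡ-+ b k n ⟨
    (b ℕ.+ k) % n          ∎
    where open ≡-Reasoning

  [m+[n∸k]]+k%n≡m%n : ∀ m {k} → k ℕ.≤ n → (m ℕ.+ (n ∸ k) ℕ.+ k) % n ≡ m % n
  [m+[n∸k]]+k%n≡m%n m {k} k≤n = begin
    (m ℕ.+ (n ∸ k) ℕ.+ k) % n   ≡⟨ ≡.cong (_% n) (ℕ.+-assoc m (n ∸ k) k) ⟩
    (m ℕ.+ (n ∸ k ℕ.+ k)) % n   ≡⟨ ≡.cong (λ r → (m ℕ.+ r) % n) (ℕ.m∸n+n≡m k≤n) ⟩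
    (m ℕ.+ n) % n               ≡⟨ [m+n]%n≡m%n m n ⟩
    m % n                       ∎
    where open ≡-Reasoning

  %-+-cancelʳ : ∀ {a b k} → k ℕ.≤ n → (a ℕ.+ k) % n ≡ (b ℕ.+ k) % n → a % n ≡ b % n
  %-+-cancelʳ {a} {b} {k} k≤n eq = ≡.trans (≡.sym (shift a)) (≡.trans (%-+-congˡ (n ∸ k) eq) (shift b))
    where
    open ≡-Reasoning
    shift : ∀ a → (a ℕ.+ k ℕ.+ (n ∸ k)) % n ≡ a % n
    shift a = ≡.trans
      (≡.cong (_% n) (≡.trans (ℕ.+-assoc a k _) (≡.trans (≡.cong (a ℕ.+_) (ℕ.+-comm k _)) (≡.sym (ℕ.+-assoc a _ k)))))
      ([m+[n∸k]]+k%n≡m%n a k≤n)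

  toℕ-mod : ∀ m → toℕ (m mod n) ≡ m % n
  toℕ-mod m = Fin.toℕ-fromℕ< (m%n<n m n)

  mod-cong : ∀ {a b} → a % n ≡ b % n → a mod n ≡ b mod n
  mod-cong {a} {b} a≡b = Fin.toℕ-injective (≡.trans (toℕ-mod a) (≡.trans a≡b (≡.sym (toℕ-mod b))))

  toℕ≤n : ∀ (k : Fin n) → toℕ k ℕ.≤ n
  toℕ≤n k = ℕ.<⇒≤ (Fin.toℕ<n k)

  -- The residue of t - k, written exactly as in `circ`, so that entry (r, s) of a circulant is
  -- definitionally its vector at `reflect (toℕ s) r`.
  reflect : ℕ → Fin n → Fin n
  reflect t k = (t ℕ.+ (n ∸ toℕ k)) mod n

  reflect-+ : ∀ t k → (toℕ (reflect t k) ℕ.+ toℕ k) % n ≡ t % n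
  reflect-+ t k = ≡.trans (%-+-congˡ (toℕ k) toℕ-reflect) ([m+[n∸k]]+k%n≡m%n t (toℕ≤n k))
    where
    toℕ-reflect : toℕ (reflect t k) % n ≡ (t ℕ.+ (n ∸ toℕ k)) % n
    toℕ-reflect = ≡.trans (≡.cong (_% n) (toℕ-mod _)) (m%n%n≡m%n (t ℕ.+ (n ∸ toℕ k)) n)

  reflect-involutive : ∀ t k → reflect t (reflect t k) ≡ k
  reflect-involutive t k = Fin.toℕ-injective (begin
    toℕ (reflect t k′)      ≡⟨ m<n⇒m%n≡m (Fin.toℕ<n (reflect t k′)) ⟨
    toℕ (reflect t k′) % n  ≡⟨ %-+-cancelʳ (toℕ≤n k′) (≡.trans (reflect-+ t k′)
                                 (≡.trans (≡.sym (reflect-+ t k)) (≡.cong (_% n) (ℕ.+-comm (toℕ k′) (toℕ k))))) ⟩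
    toℕ k % n               ≡⟨ m<n⇒m%n≡m (Fin.toℕ<n k) ⟩
    toℕ k                   ∎)
    where
    open ≡-Reasoning
    k′ = reflect t k

  reflection : ℕ → Permutation n n
  reflection t = permutation (reflect t) (reflect t) (reflect-involutive t) (reflect-involutive t)

  open CommutativeSemigroupProperties ℕ.+-commutativeSemigroup using (xy∙z≈xz∙y)

  -- This is (i + j - k) - j = i - k. For a circulant it says that entry (k, i) equals entry (j, i +
  -- j - k), which exchanges the roles of rows and columns.
  reflect-shift : ∀ i j k → reflect (toℕ (reflect (i ℕ.+ toℕ j) k)) j ≡ reflect i k
  reflect-shift i j k = Fin.toℕ-injective (begin
    toℕ b      ≡⟨ m<n⇒m%n≡m (Fin.toℕ<n b) ⟨
    toℕ b % n  ≡⟨ %-+-cancelʳ (toℕ≤n j) (%-+-cancelʳ (toℕ≤n k) b+j+k≡a+j+k) ⟩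
    toℕ a % n  ≡⟨ m<n⇒m%n≡m (Fin.toℕ<n a) ⟩
    toℕ a      ∎)
    where
    open ≡-Reasoning
    k′ = reflect (i ℕ.+ toℕ j) k
    a  = reflect i k
    b  = reflect (toℕ k′) j
    b+j+k≡a+j+k : (toℕ b ℕ.+ toℕ j ℕ.+ toℕ k) % n ≡ (toℕ a ℕ.+ toℕ j ℕ.+ toℕ k) % n
    b+j+k≡a+j+k = begin
      (toℕ b ℕ.+ toℕ j ℕ.+ toℕ k) % n  ≡⟨ %-+-congˡ (toℕ k) (reflect-+ (toℕ k′) j) ⟩
      (toℕ k′ ℕ.+ toℕ k) % n           ≡⟨ reflect-+ (i ℕ.+ toℕ j) k ⟩
      (i ℕ.+ toℕ j) % n                ≡⟨ %-+-congˡ (toℕ j) (reflect-+ i k) ⟨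
      (toℕ a ℕ.+ toℕ k ℕ.+ toℕ j) % n  ≡⟨ ≡.cong (_% n) (xy∙z≈xz∙y (toℕ a) (toℕ k) (toℕ j)) ⟩
      (toℕ a ℕ.+ toℕ j ℕ.+ toℕ k) % n  ∎

-- Matrices over a commutative ring with conjugation

record IsConjugation {c ℓ} (A : CommutativeRing c ℓ)
                     (conj : CommutativeRing.Carrier A → CommutativeRing.Carrier A) : Set (c ⊔ ℓ) where
  open CommutativeRing A
  field
    conj-cong       : ∀ {x y} → x ≈ y → conj x ≈ conj y
    conj-+          : ∀ x y → conj (x + y) ≈ conj x + conj y
    conj-*          : ∀ x y → conj (x * y) ≈ conj x * conj y
    conj-involutive : ∀ x → conj (conj x) ≈ x
    conj-0          : conj 0# ≈ 0#
    conj-1          : conj 1# ≈ 1#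

module StarAlgebra {c ℓ} (A : CommutativeRing c ℓ)
                   {conj : CommutativeRing.Carrier A → CommutativeRing.Carrier A}
                   (isConjugation : IsConjugation A conj) where

  open CommutativeRing A
  open IsConjugation isConjugation
  open SemiringSum semiring using (sum-syntax; sum-cong-≋; sum-replicate; sum-replicate-zero; ∑-comm; ∑-permute; *-distribˡ-sum; *-distribʳ-sum)
  open SemiringMult semiring using (×-assoc-*; ×-congʳ) renaming (_×_ to _·_)
  open CommutativeSemiringExp commutativeSemiring using (_^_; ^-congˡ; ^-homo-*; ^-assocʳ; ^-distrib-*)
  open IntegerCoefficients A using (solve; _:=_; _:+_; _:-_; _:*_; :-_; :1)
  open SetoidReasoning setoid

  conj-^ : ∀ x n → conj (x ^ n) ≈ conj x ^ n
  conj-^ x zero    = conj-1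
  conj-^ x (suc n) = trans (conj-* x (x ^ n)) (*-congˡ (conj-^ x n))

  conj-∑ : ∀ {n} (f : Fin n → Carrier) → conj (∑[ i < n ] f i) ≈ ∑[ i < n ] conj (f i)
  conj-∑ {zero}  f = conj-0
  conj-∑ {suc n} f = trans (conj-+ _ _) (+-congˡ (conj-∑ (f ∘ suc)))

  ∑-zero : ∀ {n} {f : Fin n → Carrier} → (∀ i → f i ≈ 0#) → ∑[ i < n ] f i ≈ 0#
  ∑-zero {n} f≈0 = trans (sum-cong-≋ {n} f≈0) (sum-replicate-zero n)

  δ : ∀ {n} → Fin n → Fin n → Carrier
  δ i j = if does (i Fin.≟ j) then 1# else 0#

  δ-≡ : ∀ {n} (i : Fin n) → δ i i ≈ 1#
  δ-≡ i with i Fin.≟ i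
  ... | yes _   = refl
  ... | no  i≢i = contradiction ≡.refl i≢i

  δ-≢ : ∀ {n} {i j : Fin n} → i ≢ j → δ i j ≈ 0#
  δ-≢ {i = i} {j} i≢j with i Fin.≟ j
  ... | yes i≡j = contradiction i≡j i≢j
  ... | no  _   = refl

  δ-comm : ∀ {n} (i j : Fin n) → δ i j ≈ δ j i
  δ-comm i j with i Fin.≟ j
  ... | yes ≡.refl = sym (δ-≡ i)
  ... | no  i≢j    = sym (δ-≢ (i≢j ∘ ≡.sym))

  conj-δ : ∀ {n} (i j : Fin n) → conj (δ i j) ≈ δ i j
  conj-δ i j with i Fin.≟ j
  ... | yes _ = conj-1
  ... | no  _ = conj-0

  ∑-δ : ∀ {n} (i : Fin n) (f : Vector Carrier n) → ∑[ k < n ] (δ i k * f k) ≈ f i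
  ∑-δ {suc n} zero    f = trans
    (+-cong (*-identityˡ _) (∑-zero (λ k → zeroˡ (f (suc k))))) (+-identityʳ _)
  ∑-δ {suc n} (suc i) f = trans
    (+-cong (zeroˡ _) (∑-δ i (f ∘ suc))) (+-identityˡ _)

  Matrix : ℕ → Set c
  Matrix n = Fin n → Fin n → Carrier

  -- U U† = x I and U† U = x I. They are kept apart because they serve different ends: the first
  -- yields spanning columns, the second independent and orthonormal ones.
  RowsOrthogonal ColumnsOrthogonal : ∀ {n} → Carrier → Matrix n → Set ℓ
  RowsOrthogonal    {n} x U = ∀ i j → ∑[ k < n ] (U i k * conj (U j k)) ≈ x * δ i j
  ColumnsOrthogonal {n} x U = ∀ i j → ∑[ k < n ] (conj (U k i) * U k j) ≈ x * δ i j

  module _ {n : ℕ} {U : Matrix n} where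

    -- Applying U† to U a = 0 returns a.
    columns-independent : ColumnsOrthogonal 1# U → ∀ (a : Vector Carrier n) →
      (∀ i → ∑[ j < n ] (a j * U i j) ≈ 0#) → ∀ j → a j ≈ 0#
    columns-independent U†U≈1 a comb≈0 j = begin
      a j
        ≈⟨ ∑-δ j a ⟨
      ∑[ k < n ] (δ j k * a k)
        ≈⟨ sum-cong-≋ {n} (λ k → *-congʳ (trans (sym (*-identityˡ _)) (sym (U†U≈1 j k)))) ⟩
      ∑[ k < n ] (∑[ i < n ] (conj (U i j) * U i k) * a k)
        ≈⟨ sum-cong-≋ {n} (λ k → *-distribʳ-sum {n} (a k) _) ⟩
      ∑[ k < n ] ∑[ i < n ] (conj (U i j) * U i k * a k)
        ≈⟨ ∑-comm {n} {n} _ ⟩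
      ∑[ i < n ] ∑[ k < n ] (conj (U i j) * U i k * a k)
        ≈⟨ sum-cong-≋ {n} (λ i → trans
             (sum-cong-≋ {n} (λ k → trans (*-assoc _ _ _) (*-congˡ (*-comm _ _))))
             (sym (*-distribˡ-sum {n} (conj (U i j)) _))) ⟩
      ∑[ i < n ] (conj (U i j) * ∑[ k < n ] (a k * U i k))
        ≈⟨ ∑-zero (λ i → trans (*-congˡ (comb≈0 i)) (zeroʳ _)) ⟩
      0# ∎

    -- The coefficients are the inner products of the columns with v, that is a = U† v, and then U a
    -- = U U† v = v.
    columns-spanning : RowsOrthogonal 1# U → ∀ (v : Vector Carrier n) →
      ∃[ a ] ∀ i → ∑[ j < n ] (a j * U i j) ≈ v i
    columns-spanning UU†≈1 v = (λ j → ∑[ k < n ] (conj (U k j) * v k)) , λ i → begin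
      ∑[ j < n ] (∑[ k < n ] (conj (U k j) * v k) * U i j)
        ≈⟨ sum-cong-≋ {n} (λ j → *-distribʳ-sum {n} (U i j) _) ⟩
      ∑[ j < n ] ∑[ k < n ] (conj (U k j) * v k * U i j)
        ≈⟨ ∑-comm {n} {n} _ ⟩
      ∑[ k < n ] ∑[ j < n ] (conj (U k j) * v k * U i j)
        ≈⟨ sum-cong-≋ {n} (λ k → trans
             (sum-cong-≋ {n} (λ j → solve 3 (λ x y z → x :* y :* z := z :* x :* y) refl _ _ _))
             (sym (*-distribʳ-sum {n} (v k) _))) ⟩
      ∑[ k < n ] (∑[ j < n ] (U i j * conj (U k j)) * v k)
        ≈⟨ sum-cong-≋ {n} (λ k → *-congʳ (trans (UU†≈1 i k) (*-identityˡ _))) ⟩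
      ∑[ k < n ] (δ i k * v k)
        ≈⟨ ∑-δ i v ⟩
      v i ∎

    module _ {x r : Carrier} (conj-r : conj r ≈ r) (r*r*x≈1 : r * r * x ≈ 1#) where

      -- Here `r` stands for a real 1/√x; being fixed by conjugation and satisfying r² x = 1
      -- expresses this inside the ring.
      rows-normalise : RowsOrthogonal x U → RowsOrthogonal 1# (λ i j → r * U i j)
      rows-normalise UU†≈x i j = begin
        ∑[ k < n ] (r * U i k * conj (r * U j k))
          ≈⟨ sum-cong-≋ {n} (λ k → trans (*-congˡ (trans (conj-* r (U j k)) (*-congʳ conj-r)))
               (solve 3 (λ r u v → r :* u :* (r :* v) := r :* r :* (u :* v)) refl _ _ _)) ⟩
        ∑[ k < n ] (r * r * (U i k * conj (U j k)))
          ≈⟨ *-distribˡ-sum {n} (r * r) _ ⟨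
        r * r * ∑[ k < n ] (U i k * conj (U j k))
          ≈⟨ *-congˡ (UU†≈x i j) ⟩
        r * r * (x * δ i j)
          ≈⟨ *-assoc _ _ _ ⟨
        r * r * x * δ i j
          ≈⟨ *-congʳ r*r*x≈1 ⟩
        1# * δ i j ∎

      columns-normalise : ColumnsOrthogonal x U → ColumnsOrthogonal 1# (λ i j → r * U i j)
      columns-normalise U†U≈x i j = begin
        ∑[ k < n ] (conj (r * U k i) * (r * U k j))
          ≈⟨ sum-cong-≋ {n} (λ k → trans (*-congʳ (trans (conj-* r (U k i)) (*-congʳ conj-r)))
               (solve 3 (λ r u v → r :* u :* (r :* v) := r :* r :* (u :* v)) refl _ _ _)) ⟩
        ∑[ k < n ] (r * r * (conj (U k i) * U k j))
          ≈⟨ *-distribˡ-sum {n} (r * r) _ ⟨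
        r * r * ∑[ k < n ] (conj (U k i) * U k j)
          ≈⟨ *-congˡ (U†U≈x i j) ⟩
        r * r * (x * δ i j)
          ≈⟨ *-assoc _ _ _ ⟨
        r * r * x * δ i j
          ≈⟨ *-congʳ r*r*x≈1 ⟩
        1# * δ i j ∎

  δ-rowsOrthogonal : ∀ {n} → RowsOrthogonal {n} 1# δ
  δ-rowsOrthogonal i j = trans (∑-δ i (λ k → conj (δ j k)))
    (trans (conj-δ j i) (trans (δ-comm j i) (sym (*-identityˡ _))))

  δ-columnsOrthogonal : ∀ {n} → ColumnsOrthogonal {n} 1# δ
  δ-columnsOrthogonal {n} i j = trans
    (sum-cong-≋ {n} (λ k → *-congʳ (trans (conj-δ k i) (δ-comm k i))))
    (trans (∑-δ i (λ k → δ k j)) (sym (*-identityˡ _)))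

  circulant : ∀ n .{{_ : NonZero n}} → Vector Carrier n → Matrix n
  circulant n v i j = v (reflect n (toℕ j) i)

  -- Reflecting the summation index, k ↦ i + j − k, turns an entry of C† C
  -- into one of C C†.
  circulant-columnsOrthogonal : ∀ n .{{_ : NonZero n}} {x} v →
    RowsOrthogonal x (circulant n v) → ColumnsOrthogonal x (circulant n v)
  circulant-columnsOrthogonal n {x} v CC†≈x i j = begin
    ∑[ k < n ] (conj (C k i) * C k j)
      ≡⟨⟩
    ∑[ k < n ] (conj (v (reflect n (toℕ i) k)) * v (reflect n (toℕ j) k))
      ≈⟨ sum-cong-≋ {n} (λ k → *-cong
           (conj-cong (reflexive (≡.cong v (≡.sym (reflect-shift n (toℕ i) j k)))))
           (reflexive (≡.cong v (≡.trans (≡.sym (reflect-shift n (toℕ j) i k))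
             (≡.cong (λ t → reflect n (toℕ (reflect n t k)) i) (ℕ.+-comm (toℕ j) (toℕ i))))))) ⟩
    ∑[ k < n ] (conj (C j (ρ k)) * C i (ρ k))
      ≈⟨ sum-cong-≋ {n} (λ k → *-comm _ _) ⟩
    ∑[ k < n ] (C i (ρ k) * conj (C j (ρ k)))
      ≈⟨ ∑-permute (λ k → C i k * conj (C j k)) (reflection n (toℕ i ℕ.+ toℕ j)) ⟨
    ∑[ k < n ] (C i k * conj (C j k))
      ≈⟨ CC†≈x i j ⟩
    x * δ i j ∎
    where
    C = circulant n v
    ρ = reflect n (toℕ i ℕ.+ toℕ j)

  -- The Fourier matrix of a primitive root of unity

  module _ (cancel : ∀ {x y : Carrier} → ¬ (x ≈ 0#) → x * y ≈ 0# → y ≈ 0#) (n : ℕ) .{{_ : NonZero n}}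
    {ω : Carrier} (ωω̄≈1 : ω * conj ω ≈ 1#) (ω^n≈1 : ω ^ n ≈ 1#)
    where

    N : Carrier
    N = n · 1#

    fourier : Matrix n
    fourier j k = ω ^ (toℕ j ℕ.* toℕ k)

    1^ : ∀ k → 1# ^ k ≈ 1#
    1^ zero    = refl
    1^ (suc k) = trans (*-identityˡ _) (1^ k)

    ω^kω̄^k≈1 : ∀ k → ω ^ k * conj ω ^ k ≈ 1#
    ω^kω̄^k≈1 k = trans (sym (^-distrib-* ω (conj ω) k)) (trans (^-congˡ k ωω̄≈1) (1^ k))

    ω^nk≈1 : ∀ k → (ω ^ k) ^ n ≈ 1#
    ω^nk≈1 k = begin
      (ω ^ k) ^ n     ≈⟨ ^-assocʳ ω k n ⟩
      ω ^ (k ℕ.* n)   ≡⟨ ≡.cong (ω ^_) (ℕ.*-comm k n) ⟩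
      ω ^ (n ℕ.* k)   ≈⟨ ^-assocʳ ω n k ⟨
      (ω ^ n) ^ k     ≈⟨ ^-congˡ k ω^n≈1 ⟩
      1# ^ k          ≈⟨ 1^ k ⟩
      1#              ∎

    geometric : ∀ x m → (x - 1#) * ∑[ k < m ] (x ^ toℕ k) ≈ x ^ m - 1#
    geometric x zero    = trans (zeroʳ _) (sym (-‿inverseʳ 1#))
    geometric x (suc m) = begin
      (x - 1#) * (1# + ∑[ k < m ] (x * x ^ toℕ k))
        ≈⟨ *-congˡ (+-congˡ (*-distribˡ-sum {m} x _)) ⟨
      (x - 1#) * (1# + x * ∑[ k < m ] (x ^ toℕ k))
        ≈⟨ solve 2 (λ x s → (x :- :1) :* (:1 :+ x :* s) := x :- :1 :+ x :* ((x :- :1) :* s)) refl _ _ ⟩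
      x - 1# + x * ((x - 1#) * ∑[ k < m ] (x ^ toℕ k))
        ≈⟨ +-congˡ (*-congˡ (geometric x m)) ⟩
      x - 1# + x * (x ^ m - 1#)
        ≈⟨ solve 2 (λ x y → x :- :1 :+ x :* (y :- :1) := x :* y :- :1) refl _ _ ⟩
      x * x ^ m - 1# ∎

    module _ (ω^k≉1 : ∀ {k : ℕ} → 0 ℕ.< k → k ℕ.< n → ¬ (ω ^ k ≈ 1#)) where

      -- Since conj ω is the inverse of ω, an equality ω^i = ω^j would give ω^(j - i) = 1 with 0 < j
      -- - i < n.
      ω^-injective-< : ∀ {i j} → i ℕ.< j → j ℕ.< n → ¬ (ω ^ i ≈ ω ^ j)
      ω^-injective-< {i} {j} i<j j<n eq = ω^k≉1 (ℕ.m<n⇒0<n∸m i<j) (ℕ.≤-<-trans (ℕ.m∸n≤m j i) j<n) (begin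
        ω ^ (j ∸ i)                           ≈⟨ *-identityˡ _ ⟨
        1# * ω ^ (j ∸ i)                      ≈⟨ *-congʳ (ω^kω̄^k≈1 i) ⟨
        ω ^ i * conj ω ^ i * ω ^ (j ∸ i)      ≈⟨ solve 3 (λ x y z → x :* y :* z := x :* z :* y) refl _ _ _ ⟩
        ω ^ i * ω ^ (j ∸ i) * conj ω ^ i      ≈⟨ *-congʳ (^-homo-* ω i (j ∸ i)) ⟨
        ω ^ (i ℕ.+ (j ∸ i)) * conj ω ^ i      ≡⟨ ≡.cong (λ m → ω ^ m * conj ω ^ i) (ℕ.m+[n∸m]≡n (ℕ.<⇒≤ i<j)) ⟩
        ω ^ j * conj ω ^ i                    ≈⟨ *-congʳ eq ⟨
        ω ^ i * conj ω ^ i                    ≈⟨ ω^kω̄^k≈1 i ⟩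
        1#                                    ∎)

      ω^-injective : ∀ {i j : Fin n} → i ≢ j → ¬ (ω ^ toℕ i ≈ ω ^ toℕ j)
      ω^-injective {i} {j} i≢j eq with ℕ.<-cmp (toℕ i) (toℕ j)
      ... | tri< i<j _ _ = ω^-injective-< i<j (Fin.toℕ<n j) eq
      ... | tri≈ _ i≡j _ = i≢j (Fin.toℕ-injective i≡j)
      ... | tri> _ _ j<i = ω^-injective-< j<i (Fin.toℕ<n i) (sym eq)

      fourier-term : ∀ i j k → ω ^ (i ℕ.* k) * conj (ω ^ (j ℕ.* k)) ≈ (ω ^ i * conj ω ^ j) ^ k
      fourier-term i j k = begin
        ω ^ (i ℕ.* k) * conj (ω ^ (j ℕ.* k))    ≈⟨ *-congˡ (conj-^ ω (j ℕ.* k)) ⟩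
        ω ^ (i ℕ.* k) * conj ω ^ (j ℕ.* k)      ≈⟨ *-cong (^-assocʳ ω i k) (^-assocʳ (conj ω) j k) ⟨
        (ω ^ i) ^ k * (conj ω ^ j) ^ k          ≈⟨ ^-distrib-* _ _ k ⟨
        (ω ^ i * conj ω ^ j) ^ k                ∎

      -- The product of two rows is a geometric sum with ratio ζ = ω^i (conj ω)^j. On the diagonal ζ
      -- = 1 and the sum counts its terms; elsewhere ζ^n = 1 but ζ ≠ 1, so the factor ζ - 1 is
      -- cancelled from (ζ - 1) Σ ζ^k = 0.
      fourier-rowsOrthogonal : RowsOrthogonal N fourier
      fourier-rowsOrthogonal i j = trans (sum-cong-≋ {n} (λ k → fourier-term (toℕ i) (toℕ j) (toℕ k))) (case i j)
        where
        case : ∀ i j → ∑[ k < n ] ((ω ^ toℕ i * conj ω ^ toℕ j) ^ toℕ k) ≈ N * δ i j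
        case i j with i Fin.≟ j
        ... | yes ≡.refl = trans
          (trans (sum-cong-≋ {n} (λ k → trans (^-congˡ (toℕ k) (ω^kω̄^k≈1 (toℕ i))) (1^ (toℕ k)))) (sum-replicate n))
          (sym (*-identityʳ N))
        ... | no i≢j = trans (cancel ζ-1≉0 (trans (geometric ζ n) (trans (+-congʳ ζ^n≈1) (-‿inverseʳ 1#)))) (sym (zeroʳ N))
          where
          ζ = ω ^ toℕ i * conj ω ^ toℕ j

          ζ^n≈1 : ζ ^ n ≈ 1#
          ζ^n≈1 = begin
            ζ ^ n                                      ≈⟨ ^-distrib-* _ _ n ⟩
            (ω ^ toℕ i) ^ n * (conj ω ^ toℕ j) ^ n     ≈⟨ *-congˡ (^-congˡ n (conj-^ ω (toℕ j))) ⟨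
            (ω ^ toℕ i) ^ n * conj (ω ^ toℕ j) ^ n     ≈⟨ *-congˡ (conj-^ (ω ^ toℕ j) n) ⟨
            (ω ^ toℕ i) ^ n * conj ((ω ^ toℕ j) ^ n)   ≈⟨ *-cong (ω^nk≈1 (toℕ i)) (trans (conj-cong (ω^nk≈1 (toℕ j))) conj-1) ⟩
            1# * 1#                                    ≈⟨ *-identityˡ 1# ⟩
            1#                                         ∎

          ζ-1≉0 : ¬ (ζ - 1# ≈ 0#)
          ζ-1≉0 ζ-1≈0 = ω^-injective i≢j (begin
            ω ^ toℕ i                                     ≈⟨ *-identityʳ _ ⟨
            ω ^ toℕ i * 1#                                ≈⟨ *-congˡ (ω^kω̄^k≈1 (toℕ j)) ⟨
            ω ^ toℕ i * (ω ^ toℕ j * conj ω ^ toℕ j)      ≈⟨ solve 3 (λ x y z → x :* (y :* z) := (x :* z :- :1) :* y :+ y) refl _ _ _ ⟩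
            (ζ - 1#) * ω ^ toℕ j + ω ^ toℕ j              ≈⟨ +-congʳ (trans (*-congʳ ζ-1≈0) (zeroˡ _)) ⟩
            0# + ω ^ toℕ j                                ≈⟨ +-identityˡ _ ⟩
            ω ^ toℕ j                                     ∎)

      fourier-columnsOrthogonal : ColumnsOrthogonal N fourier
      fourier-columnsOrthogonal i j = begin
        ∑[ k < n ] (conj (fourier k i) * fourier k j)
          ≈⟨ sum-cong-≋ {n} (λ k → trans (*-comm _ _) (*-cong (fourier-sym k j) (conj-cong (fourier-sym k i)))) ⟩
        ∑[ k < n ] (fourier j k * conj (fourier i k))
          ≈⟨ fourier-rowsOrthogonal j i ⟩
        N * δ j i
          ≈⟨ *-congˡ (δ-comm j i) ⟩
        N * δ i j ∎
        where
        fourier-sym : ∀ i j → fourier i j ≈ fourier j i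
        fourier-sym i j = reflexive (≡.cong (ω ^_) (ℕ.*-comm (toℕ i) (toℕ j)))

    -- Fourier vectors against the columns of a circulant

    module _ (N≉0 : ¬ (N ≈ 0#)) {v : Vector Carrier n} (CC†≈N : RowsOrthogonal N (circulant n v)) (j : Fin n) where

      private
        C = circulant n v
        η = ω ^ toℕ j

      -- λⱼ, the eigenvalue of C at the j-th Fourier vector.
      eigenvalue : Carrier
      eigenvalue = ∑[ l < n ] (η ^ toℕ l * v l)

      inner : Fin n → Carrier
      inner k = ∑[ i < n ] (conj (fourier i j) * C i k)

      η^-% : ∀ m → η ^ toℕ (m mod n) ≈ η ^ m
      η^-% m = sym (begin
        η ^ m                                       ≡⟨ ≡.cong (η ^_) (m≡m%n+[m/n]*n m n) ⟩
        η ^ (m % n ℕ.+ m / n ℕ.* n)                 ≈⟨ ^-homo-* η (m % n) _ ⟩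
        η ^ (m % n) * η ^ (m / n ℕ.* n)             ≡⟨ ≡.cong₂ (λ x y → η ^ x * η ^ y) (≡.sym (toℕ-mod n m)) (ℕ.*-comm (m / n) n) ⟩
        η ^ toℕ (m mod n) * η ^ (n ℕ.* (m / n))     ≈⟨ *-congˡ (^-assocʳ η n (m / n)) ⟨
        η ^ toℕ (m mod n) * (η ^ n) ^ (m / n)       ≈⟨ *-congˡ (trans (^-congˡ (m / n) (ω^nk≈1 (toℕ j))) (1^ (m / n))) ⟩
        η ^ toℕ (m mod n) * 1#                      ≈⟨ *-identityʳ _ ⟩
        η ^ toℕ (m mod n)                           ∎)

      ηη̄≈1 : ∀ k → η ^ k * conj η ^ k ≈ 1#
      ηη̄≈1 k = trans (sym (^-distrib-* _ _ k)) (trans (^-congˡ k (trans (*-congˡ (conj-^ ω (toℕ j))) (ω^kω̄^k≈1 (toℕ j)))) (1^ k))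

      -- Because η^n = 1, the reflected index acts as the exponent k - l, and conj (η^(k - l)) =
      -- (conj η)^k η^l. Negative powers are avoided by inserting η^l (conj η)^l = 1.
      conj-fourier-reflect : ∀ (k l : Fin n) → conj (fourier (reflect n (toℕ k) l) j) ≈ conj η ^ toℕ k * η ^ toℕ l
      conj-fourier-reflect k l = begin
        conj (ω ^ (toℕ ρl ℕ.* toℕ j))
          ≡⟨ ≡.cong (λ m → conj (ω ^ m)) (ℕ.*-comm (toℕ ρl) (toℕ j)) ⟩
        conj (ω ^ (toℕ j ℕ.* toℕ ρl))
          ≈⟨ conj-cong (^-assocʳ ω (toℕ j) (toℕ ρl)) ⟨
        conj (η ^ toℕ ρl)
          ≈⟨ *-identityʳ _ ⟨
        conj (η ^ toℕ ρl) * 1#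
          ≈⟨ *-congˡ (ηη̄≈1 (toℕ l)) ⟨
        conj (η ^ toℕ ρl) * (η ^ toℕ l * conj η ^ toℕ l)
          ≈⟨ solve 3 (λ x y z → x :* (y :* z) := x :* z :* y) refl _ _ _ ⟩
        conj (η ^ toℕ ρl) * conj η ^ toℕ l * η ^ toℕ l
          ≈⟨ *-congʳ (trans (conj-* _ _) (*-congˡ (conj-^ η (toℕ l)))) ⟨
        conj (η ^ toℕ ρl * η ^ toℕ l) * η ^ toℕ l
          ≈⟨ *-congʳ (conj-cong η^ρl*η^l≈η^k) ⟩
        conj (η ^ toℕ k) * η ^ toℕ l
          ≈⟨ *-congʳ (conj-^ η (toℕ k)) ⟩
        conj η ^ toℕ k * η ^ toℕ l ∎
        where
        ρl = reflect n (toℕ k) l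
        η^ρl*η^l≈η^k : η ^ toℕ ρl * η ^ toℕ l ≈ η ^ toℕ k
        η^ρl*η^l≈η^k = begin
          η ^ toℕ ρl * η ^ toℕ l               ≈⟨ ^-homo-* η (toℕ ρl) (toℕ l) ⟨
          η ^ (toℕ ρl ℕ.+ toℕ l)               ≈⟨ η^-% _ ⟨
          η ^ toℕ ((toℕ ρl ℕ.+ toℕ l) mod n)   ≡⟨ ≡.cong (λ m → η ^ toℕ m) (mod-cong n (reflect-+ n (toℕ k) l)) ⟩
          η ^ toℕ (toℕ k mod n)                ≈⟨ η^-% (toℕ k) ⟩
          η ^ toℕ k                            ∎

      -- Entry (i, k) of C depends only on k - i. Summing over l = k - i instead of i frees the
      -- entry from k, which survives only in a unimodular factor.
      inner≈ : ∀ k → inner k ≈ conj η ^ toℕ k * eigenvalue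
      inner≈ k = begin
        ∑[ i < n ] (conj (fourier i j) * C i k)
          ≈⟨ ∑-permute (λ i → conj (fourier i j) * C i k) (reflection n (toℕ k)) ⟩
        ∑[ l < n ] (conj (fourier (reflect n (toℕ k) l) j) * v (reflect n (toℕ k) (reflect n (toℕ k) l)))
          ≈⟨ sum-cong-≋ {n} (λ l → trans
               (*-cong (conj-fourier-reflect k l) (reflexive (≡.cong v (reflect-involutive n (toℕ k) l))))
               (*-assoc _ _ _)) ⟩
        ∑[ l < n ] (conj η ^ toℕ k * (η ^ toℕ l * v l))
          ≈⟨ *-distribˡ-sum {n} (conj η ^ toℕ k) _ ⟨
        conj η ^ toℕ k * eigenvalue ∎

      ∣inner∣²≈∣eigenvalue∣² : ∀ k → inner k * conj (inner k) ≈ eigenvalue * conj eigenvalue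
      ∣inner∣²≈∣eigenvalue∣² k = begin
        inner k * conj (inner k)
          ≈⟨ *-cong (inner≈ k) (trans (conj-cong (inner≈ k)) (trans (conj-* _ _) (*-congʳ (trans (conj-^ (conj η) (toℕ k)) (^-congˡ (toℕ k) (conj-involutive η)))))) ⟩
        conj η ^ toℕ k * eigenvalue * (η ^ toℕ k * conj eigenvalue)
          ≈⟨ solve 4 (λ a x b y → a :* x :* (b :* y) := b :* a :* (x :* y)) refl _ _ _ _ ⟩
        η ^ toℕ k * conj η ^ toℕ k * (eigenvalue * conj eigenvalue)
          ≈⟨ trans (*-congʳ (ηη̄≈1 (toℕ k))) (*-identityˡ _) ⟩
        eigenvalue * conj eigenvalue ∎

      -- Σₖ ∣⟨φ ∣ C eₖ⟩∣² = ⟨φ ∣ C C† φ⟩ = N ⟨φ ∣ φ⟩ for the j-th Fourier vector φ.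
      ∑∣inner∣²≈N*N : ∑[ k < n ] (inner k * conj (inner k)) ≈ N * N
      ∑∣inner∣²≈N*N = begin
        ∑[ k < n ] (inner k * conj (inner k))
          ≈⟨ sum-cong-≋ {n} (λ k → expand k) ⟩
        ∑[ k < n ] ∑[ i < n ] ∑[ h < n ] (conj (f i) * f h * (C i k * conj (C h k)))
          ≈⟨ ∑-comm {n} {n} _ ⟩
        ∑[ i < n ] ∑[ k < n ] ∑[ h < n ] (conj (f i) * f h * (C i k * conj (C h k)))
          ≈⟨ sum-cong-≋ {n} (λ i → ∑-comm {n} {n} _) ⟩
        ∑[ i < n ] ∑[ h < n ] ∑[ k < n ] (conj (f i) * f h * (C i k * conj (C h k)))
          ≈⟨ sum-cong-≋ {n} (λ i → sum-cong-≋ {n} (λ h → begin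
               ∑[ k < n ] (conj (f i) * f h * (C i k * conj (C h k))) ≈⟨ *-distribˡ-sum {n} _ _ ⟨
               conj (f i) * f h * ∑[ k < n ] (C i k * conj (C h k))   ≈⟨ *-congˡ (CC†≈N i h) ⟩
               conj (f i) * f h * (N * δ i h)                         ≈⟨ solve 4 (λ a b n d → a :* b :* (n :* d) := d :* (n :* (a :* b))) refl _ _ _ _ ⟩
               δ i h * (N * (conj (f i) * f h))                       ∎)) ⟩
        ∑[ i < n ] ∑[ h < n ] (δ i h * (N * (conj (f i) * f h)))
          ≈⟨ sum-cong-≋ {n} (λ i → ∑-δ i (λ h → N * (conj (f i) * f h))) ⟩
        ∑[ i < n ] (N * (conj (f i) * f i))
          ≈⟨ *-distribˡ-sum {n} N _ ⟨
        N * ∑[ i < n ] (conj (f i) * f i)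
          ≈⟨ *-congˡ (trans (sum-cong-≋ {n} unit) (sum-replicate n)) ⟩
        N * N ∎
        where
        f : Fin n → Carrier
        f i = fourier i j

        unit : ∀ i → conj (f i) * f i ≈ 1#
        unit i = trans (*-comm _ _) (trans (*-congˡ (conj-^ ω (toℕ i ℕ.* toℕ j))) (ω^kω̄^k≈1 (toℕ i ℕ.* toℕ j)))

        expand : ∀ k → inner k * conj (inner k) ≈ ∑[ i < n ] ∑[ h < n ] (conj (f i) * f h * (C i k * conj (C h k)))
        expand k = begin
          inner k * conj (inner k)
            ≈⟨ *-distribʳ-sum {n} (conj (inner k)) _ ⟩
          ∑[ i < n ] (conj (f i) * C i k * conj (inner k))
            ≈⟨ sum-cong-≋ {n} (λ i → trans (*-congˡ (conj-∑ {n} _)) (*-distribˡ-sum {n} _ _)) ⟩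
          ∑[ i < n ] ∑[ h < n ] (conj (f i) * C i k * conj (conj (f h) * C h k))
            ≈⟨ sum-cong-≋ {n} (λ i → sum-cong-≋ {n} (λ h → trans
                 (*-congˡ (trans (conj-* _ _) (*-congʳ (conj-involutive (f h)))))
                 (solve 4 (λ a b x y → a :* b :* (x :* y) := a :* x :* (b :* y)) refl _ _ _ _))) ⟩
          ∑[ i < n ] ∑[ h < n ] (conj (f i) * f h * (C i k * conj (C h k))) ∎

      -- All n summands of `∑∣inner∣²≈N*N` equal q, whence N q = N N. The cancellation law concerns
      -- products that vanish, so it is applied to N (q - N) = 0.
      ∣inner∣²≈N : ∀ k → inner k * conj (inner k) ≈ N
      ∣inner∣²≈N k = begin
        inner k * conj (inner k)        ≈⟨ ∣inner∣²≈∣eigenvalue∣² k ⟩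
        q                               ≈⟨ solve 2 (λ q n → q := q :- n :+ n) refl q N ⟩
        q - N + N                       ≈⟨ +-congʳ (cancel N≉0 N*[q-N]≈0) ⟩
        0# + N                          ≈⟨ +-identityˡ N ⟩
        N                               ∎
        where
        q = eigenvalue * conj eigenvalue
        Nq≈NN : N * q ≈ N * N
        Nq≈NN = begin
          N * q                                  ≈⟨ ×-assoc-* n 1# q ⟩
          n · (1# * q)                           ≈⟨ ×-congʳ n (*-identityˡ q) ⟩
          n · q                                  ≈⟨ sum-replicate n ⟨
          ∑[ _ < n ] q                           ≈⟨ sum-cong-≋ {n} ∣inner∣²≈∣eigenvalue∣² ⟨
          ∑[ k < n ] (inner k * conj (inner k))  ≈⟨ ∑∣inner∣²≈N*N ⟩
          N * N                                  ∎
        N*[q-N]≈0 : N * (q - N) ≈ 0#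
        N*[q-N]≈0 = begin
          N * (q - N)     ≈⟨ solve 2 (λ n q → n :* (q :- n) := n :* q :- n :* n) refl N q ⟩
          N * q - N * N   ≈⟨ +-congʳ Nq≈NN ⟩
          N * N - N * N   ≈⟨ -‿inverseʳ _ ⟩
          0#              ∎

-- Ordered field arithmetic from the constructive axioms

module OrderedField {c ℓ₁ ℓ₂ ℓ₃} (R : RealNumbers c ℓ₁ ℓ₂ ℓ₃) where

  open RealNumbers R public
  open CommutativeRing commutativeRing public using (semiring)
  open SemiringMult semiring using (×-homo-+; ×1-homo-*)
  open SemiringExp semiring public using (_^_; ^-homo-*)
  module Solver = IntegerCoefficients commutativeRing
  open Solver using (solve; _:=_; _:+_; _:-_; _:*_; :-_; :0; :1)

  infix 4 _≉_
  _≉_ : Carrier → Carrier → Set _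
  x ≉ y = ¬ (x ≈ y)

  <-asym : ∀ {x y} → x < y → ¬ (y < x)
  <-asym = IsStrictPartialOrder.asym isStrictPartialOrder

  -- The substitute for deciding how two numbers compare. It comes from cotransitivity of apartness;
  -- transitivity turns each apartness on the wrong side into the other alternative.
  <-cotrans : ∀ {x y} → x < y → ∀ z → x < z ⊎ z < y
  <-cotrans x<y z with #-cotrans (<⇒# x<y) z
  ... | inj₁ x#z with #⇒<⊎> x#z
  ...   | inj₁ x<z = inj₁ x<z
  ...   | inj₂ z<x = inj₂ (<-trans z<x x<y)
  <-cotrans x<y z | inj₂ z#y with #⇒<⊎> z#y
  ...   | inj₁ z<y = inj₂ z<y
  ...   | inj₂ y<z = inj₁ (<-trans x<y y<z)

  <⇒≤ : ∀ {x y} → x < y → x ≤ y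
  <⇒≤ = <-asym

  ≤-reflexive : ∀ {x y} → x ≈ y → x ≤ y
  ≤-reflexive x≈y = <-irrefl (sym x≈y)

  ≤-refl : ∀ {x} → x ≤ x
  ≤-refl = ≤-reflexive refl

  <-≤-trans : ∀ {x y z} → x < y → y ≤ z → x < z
  <-≤-trans {z = z} x<y y≤z with <-cotrans x<y z
  ... | inj₁ x<z = x<z
  ... | inj₂ z<y = contradiction z<y y≤z

  ≤-<-trans : ∀ {x y z} → x ≤ y → y < z → x < z
  ≤-<-trans {x} x≤y y<z with <-cotrans y<z x
  ... | inj₁ y<x = contradiction y<x x≤y
  ... | inj₂ x<z = x<z

  ≤-trans : ∀ {x y z} → x ≤ y → y ≤ z → x ≤ z
  ≤-trans x≤y y≤z z<x = x≤y (≤-<-trans y≤z z<x)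

  ¬#⇒≈ : ∀ {x y} → ¬ (x # y) → x ≈ y
  ¬#⇒≈ = proj₁ (tight _ _)

  ≤-antisym : ∀ {x y} → x ≤ y → y ≤ x → x ≈ y
  ≤-antisym x≤y y≤x = ¬#⇒≈ λ x#y → case (#⇒<⊎> x#y)
    where
    case : _ → _
    case (inj₁ x<y) = y≤x x<y
    case (inj₂ y<x) = x≤y y<x

  -- Tightness makes equality the negation of apartness, so equations may be proved by
  -- contradiction.
  ≈-stable : ∀ {x y} → ¬ (x ≉ y) → x ≈ y
  ≈-stable ¬x≉y = ¬#⇒≈ λ x#y → ¬x≉y λ x≈y → proj₂ (tight _ _) x≈y x#y

  ≤-isPreorder : IsPreorder _≈_ _≤_
  ≤-isPreorder = record
    { isEquivalence = isEquivalence ; reflexive = ≤-reflexive ; trans = ≤-trans }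

  module ≤-Reasoning = TripleReasoning ≤-isPreorder <-asym <-trans
    (IsStrictPartialOrder.<-resp-≈ isStrictPartialOrder) <⇒≤ <-≤-trans ≤-<-trans

  open ≤-Reasoning

  +-monoʳ-< : ∀ z {x y} → x < y → z + x < z + y
  +-monoʳ-< z x<y = <-respˡ-≈ (+-comm _ z) (<-respʳ-≈ (+-comm _ z) (+-monoˡ-< z x<y))

  +-monoˡ-≤ : ∀ z {x y} → x ≤ y → x + z ≤ y + z
  +-monoˡ-≤ z {x} {y} x≤y y+z<x+z = x≤y (<-respˡ-≈ (cancel y) (<-respʳ-≈ (cancel x) (+-monoˡ-< (- z) y+z<x+z)))
    where
    cancel : ∀ w → w + z - z ≈ w
    cancel w = solve 2 (λ w z → w :+ z :- z := w) refl w z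

  +-mono-≤ : ∀ {x y u v} → x ≤ y → u ≤ v → x + u ≤ y + v
  +-mono-≤ {x} {y} {u} {v} x≤y u≤v = begin
    x + u ≤⟨ +-monoˡ-≤ u x≤y ⟩
    y + u ≈⟨ +-comm y u ⟩
    u + y ≤⟨ +-monoˡ-≤ y u≤v ⟩
    v + y ≈⟨ +-comm v y ⟩
    y + v ∎

  x<y⇒0<y-x : ∀ {x y} → x < y → 0# < y - x
  x<y⇒0<y-x {x} x<y = <-respˡ-≈ (-‿inverseʳ x) (+-monoˡ-< (- x) x<y)

  0<y-x⇒x<y : ∀ {x y} → 0# < y - x → x < y
  0<y-x⇒x<y {x} {y} 0<y-x = <-respˡ-≈ (+-identityˡ x)
    (<-respʳ-≈ (solve 2 (λ x y → y :- x :+ x := y) refl x y) (+-monoˡ-< x 0<y-x))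

  0≤y-x⇒x≤y : ∀ {x y} → 0# ≤ y - x → x ≤ y
  0≤y-x⇒x≤y {x} {y} 0≤y-x y<x = 0≤y-x
    (<-respˡ-≈ (solve 2 (λ x y → y :+ (:- x) := y :- x) refl x y)
      (<-respʳ-≈ (-‿inverseʳ x) (+-monoˡ-< (- x) y<x)))

  x≤y⇒0≤y-x : ∀ {x y} → x ≤ y → 0# ≤ y - x
  x≤y⇒0≤y-x {x} {y} x≤y = ≤-trans (≤-reflexive (sym (-‿inverseʳ x))) (+-monoˡ-≤ (- x) x≤y)

  x<0⇒0<-x : ∀ {x} → x < 0# → 0# < - x
  x<0⇒0<-x {x} x<0 = <-respʳ-≈ (+-identityˡ (- x)) (x<y⇒0<y-x x<0)

  -- Positivity is obtained only up to double negation. This is enough for goals that are negations,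
  -- such as `_≤_`, and through `≈-stable` for equations.
  0≤∧≉0⇒¬¬0< : ∀ {x} → 0# ≤ x → x ≉ 0# → ¬ ¬ (0# < x)
  0≤∧≉0⇒¬¬0< 0≤x x≉0 ¬0<x = x≉0 (≤-antisym ¬0<x 0≤x)

  0≤x*y : ∀ {x y} → 0# ≤ x → 0# ≤ y → 0# ≤ x * y
  0≤x*y {x} {y} 0≤x 0≤y xy<0 =
    0≤∧≉0⇒¬¬0< 0≤x (λ x≈0 → <-irrefl (trans (*-congʳ x≈0) (zeroˡ y)) xy<0) λ 0<x →
    0≤∧≉0⇒¬¬0< 0≤y (λ y≈0 → <-irrefl (trans (*-congˡ y≈0) (zeroʳ x)) xy<0) λ 0<y →
    <-asym xy<0 (0<x*y 0<x 0<y)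

  *-monoˡ-≤ : ∀ z {x y} → 0# ≤ z → x ≤ y → z * x ≤ z * y
  *-monoˡ-≤ z {x} {y} 0≤z x≤y = 0≤y-x⇒x≤y (≤-trans (0≤x*y 0≤z (x≤y⇒0≤y-x x≤y))
    (≤-reflexive (solve 3 (λ x y z → z :* (y :- x) := z :* y :- z :* x) refl x y z)))

  *-mono-≤ : ∀ {x y u v} → 0# ≤ x → 0# ≤ v → x ≤ y → u ≤ v → x * u ≤ y * v
  *-mono-≤ {x} {y} {u} {v} 0≤x 0≤v x≤y u≤v = begin
    x * u ≤⟨ *-monoˡ-≤ x 0≤x u≤v ⟩
    x * v ≈⟨ *-comm x v ⟩
    v * x ≤⟨ *-monoˡ-≤ v 0≤v x≤y ⟩
    v * y ≈⟨ *-comm v y ⟩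
    y * v ∎

  *-monoˡ-< : ∀ z {x y} → 0# < z → x < y → z * x < z * y
  *-monoˡ-< z {x} {y} 0<z x<y = 0<y-x⇒x<y (<-respʳ-≈
    (solve 3 (λ x y z → z :* (y :- x) := z :* y :- z :* x) refl x y z)
    (0<x*y 0<z (x<y⇒0<y-x x<y)))

  0<x+y : ∀ {x y} → 0# < x → 0# ≤ y → 0# < x + y
  0<x+y {x} {y} 0<x 0≤y = begin-strict
    0# <⟨ 0<x ⟩
    x ≈⟨ +-identityʳ x ⟨
    x + 0# ≤⟨ +-mono-≤ ≤-refl 0≤y ⟩
    x + y ∎

  0≤x+y : ∀ {x y} → 0# ≤ x → 0# ≤ y → 0# ≤ x + y
  0≤x+y 0≤x 0≤y = ≤-trans (≤-reflexive (sym (+-identityˡ 0#))) (+-mono-≤ 0≤x 0≤y)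

  x≤x+y : ∀ x {y} → 0# ≤ y → x ≤ x + y
  x≤x+y x 0≤y = ≤-trans (≤-reflexive (sym (+-identityʳ x))) (+-mono-≤ ≤-refl 0≤y)

  #0⇒0<x*x : ∀ {x} → x # 0# → 0# < x * x
  #0⇒0<x*x {x} x#0 with #⇒<⊎> x#0
  ... | inj₂ 0<x = 0<x*y 0<x 0<x
  ... | inj₁ x<0 = <-respʳ-≈ (solve 1 (λ x → :- x :* :- x := x :* x) refl x)
                     (0<x*y (x<0⇒0<-x x<0) (x<0⇒0<-x x<0))

  0≤x*x : ∀ x → 0# ≤ x * x
  0≤x*x x xx<0 = <-irrefl (trans (*-congʳ (¬#⇒≈ ¬x#0)) (zeroˡ x)) xx<0
    where
    ¬x#0 : ¬ (x # 0#)
    ¬x#0 x#0 = <-asym xx<0 (#0⇒0<x*x x#0)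

  x²+y²≈0⇒x≈0 : ∀ {x y} → x * x + y * y ≈ 0# → x ≈ 0#
  x²+y²≈0⇒x≈0 {x} {y} eq = ¬#⇒≈ λ x#0 → <-irrefl (sym eq) (0<x+y (#0⇒0<x*x x#0) (0≤x*x y))

  sqrt-mono-≤ : ∀ {x y} → 0# ≤ y → x * x ≤ y * y → x ≤ y
  sqrt-mono-≤ {x} {y} 0≤y xx≤yy y<x = xx≤yy (0<y-x⇒x<y (<-respʳ-≈
    (solve 2 (λ x y → (x :- y) :* (x :+ y) := x :* x :- y :* y) refl x y)
    (0<x*y (x<y⇒0<y-x y<x) (0<x+y (≤-<-trans 0≤y y<x) 0≤y))))

  square-mono-< : ∀ {x y} → x < y → - x < y → x * x < y * y
  square-mono-< {x} {y} x<y -x<y = 0<y-x⇒x<y (<-respʳ-≈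
    (solve 2 (λ x y → (y :- x) :* (y :- :- x) := y :* y :- x :* x) refl x y)
    (0<x*y (x<y⇒0<y-x x<y) (x<y⇒0<y-x -x<y)))

  *-cancelˡ-≈ : ∀ {x y z} → 0# < x → x * y ≈ x * z → y ≈ z
  *-cancelˡ-≈ 0<x xy≈xz = ≤-antisym
    (λ z<y → <-irrefl (sym xy≈xz) (*-monoˡ-< _ 0<x z<y))
    (λ y<z → <-irrefl xy≈xz (*-monoˡ-< _ 0<x y<z))

  recip-inverseˡ : ∀ x 0<x → recip x 0<x * x ≈ 1#
  recip-inverseˡ x 0<x = trans
    -- Invertibility is stated for differences of apart elements, so `recip` is an inverse of x - 0
    -- that has to be recognised as one of x.
    (*-congˡ (solve 1 (λ x → x := x :- :0) refl x))
    (proj₁ (proj₂ (#⇒invertible (#-sym (<⇒# 0<x)))))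

  recip-inverseʳ : ∀ x 0<x → x * recip x 0<x ≈ 1#
  recip-inverseʳ x 0<x = trans (*-comm x _) (recip-inverseˡ x 0<x)

  0<recip : ∀ x 0<x → 0# < recip x 0<x
  0<recip x 0<x with #⇒<⊎> r#0
    where
    r = recip x 0<x
    r#0 : r # 0#
    r#0 = invertible⇒# (x
      , trans (solve 2 (λ x r → x :* (r :- :0) := x :* r) refl x r) (recip-inverseʳ x 0<x)
      , trans (solve 2 (λ x r → (r :- :0) :* x := r :* x) refl x r) (recip-inverseˡ x 0<x))
  ... | inj₂ 0<r = 0<r
  ... | inj₁ r<0 = contradiction 0<1 (<-asym (begin-strict
    1#                ≈⟨ recip-inverseʳ x 0<x ⟨
    x * recip x 0<x   <⟨ *-monoˡ-< x 0<x r<0 ⟩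
    x * 0#            ≈⟨ zeroʳ x ⟩
    0#                ∎))

  1/n*n≈1 : ∀ n .{{_ : NonZero n}} → 1/ n * fromℕ n ≈ 1#
  1/n*n≈1 n = recip-inverseˡ (fromℕ n) (0<fromℕ n)

  0<1/ : ∀ n .{{_ : NonZero n}} → 0# < 1/ n
  0<1/ n = 0<recip (fromℕ n) (0<fromℕ n)

  fromℕ-+ : ∀ m n → fromℕ (m ℕ.+ n) ≈ fromℕ m + fromℕ n
  fromℕ-+ = ×-homo-+ 1#

  fromℕ-* : ∀ m n → fromℕ (m ℕ.* n) ≈ fromℕ m * fromℕ n
  fromℕ-* = ×1-homo-*

  0≤fromℕ : ∀ n → 0# ≤ fromℕ n
  0≤fromℕ zero    = ≤-refl
  0≤fromℕ (suc n) = <⇒≤ (0<fromℕ (suc n))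

  fromℕ-mono-≤ : ∀ {m n} → m ℕ.≤ n → fromℕ m ≤ fromℕ n
  fromℕ-mono-≤ {m} {n} m≤n = begin
    fromℕ m ≤⟨ x≤x+y _ (0≤fromℕ (n ℕ.∸ m)) ⟩
    fromℕ m + fromℕ (n ℕ.∸ m) ≈⟨ fromℕ-+ m (n ℕ.∸ m) ⟨
    fromℕ (m ℕ.+ (n ℕ.∸ m)) ≡⟨ ≡.cong fromℕ (ℕ.m+[n∸m]≡n m≤n) ⟩
    fromℕ n ∎

  fromℕ-mono-< : ∀ {m n} → m ℕ.< n → fromℕ m < fromℕ n
  fromℕ-mono-< {m} {n} m<n = begin-strict
    fromℕ m       <⟨ <-respˡ-≈ (+-identityˡ _) (+-monoˡ-< (fromℕ m) 0<1) ⟩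
    fromℕ (suc m) ≤⟨ fromℕ-mono-≤ m<n ⟩
    fromℕ n       ∎

  ½ : Carrier
  ½ = 1/ 2

  0<½ : 0# < ½
  0<½ = 0<1/ 2

  ½+½≈1 : ½ + ½ ≈ 1#
  ½+½≈1 = trans (solve 1 (λ h → h :+ h := h :* (:1 :+ (:1 :+ :0))) refl ½) (1/n*n≈1 2)

  0<½^ : ∀ n → 0# < ½ ^ n
  0<½^ zero    = 0<1
  0<½^ (suc n) = 0<x*y 0<½ (0<½^ n)

  ½^n≈½^[1+n]+½^[1+n] : ∀ n → ½ ^ n ≈ ½ ^ suc n + ½ ^ suc n
  ½^n≈½^[1+n]+½^[1+n] n = trans (sym (*-identityˡ (½ ^ n)))
    (trans (*-congʳ (sym ½+½≈1)) (distribʳ _ _ _))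

  ½^-suc-≤ : ∀ n → ½ ^ suc n ≤ ½ ^ n
  ½^-suc-≤ n = ≤-trans (x≤x+y (½ ^ suc n) (<⇒≤ (0<½^ (suc n)))) (≤-reflexive (sym (½^n≈½^[1+n]+½^[1+n] n)))

  ½^-antimono-≤′ : ∀ {m n} → m ℕ.≤′ n → ½ ^ n ≤ ½ ^ m
  ½^-antimono-≤′ ℕ.≤′-refl       = ≤-refl
  ½^-antimono-≤′ (ℕ.≤′-step {n} m≤n) = ≤-trans (½^-suc-≤ n) (½^-antimono-≤′ m≤n)

  ½^-antimono-≤ : ∀ {m n} → m ℕ.≤ n → ½ ^ n ≤ ½ ^ m
  ½^-antimono-≤ = ½^-antimono-≤′ ∘ ℕ.≤⇒≤′

  -- This is n ≤ 2ⁿ. In the inductive step one half comes from ½ⁿ ≤ 1 and the other from the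
  -- induction hypothesis.
  n*½^n≤1 : ∀ n → fromℕ n * ½ ^ n ≤ 1#
  n*½^n≤1 zero    = ≤-trans (≤-reflexive (zeroˡ _)) (<⇒≤ 0<1)
  n*½^n≤1 (suc n) = begin
    (1# + fromℕ n) * (½ * ½ ^ n)            ≈⟨ solve 3 (λ x h y → (:1 :+ x) :* (h :* y) := h :* y :+ h :* (x :* y)) refl (fromℕ n) ½ (½ ^ n) ⟩
    ½ * ½ ^ n + ½ * (fromℕ n * ½ ^ n)       ≤⟨ +-mono-≤ (*-monoˡ-≤ ½ (<⇒≤ 0<½) (½^-antimono-≤ {0} {n} ℕ.z≤n)) (*-monoˡ-≤ ½ (<⇒≤ 0<½) (n*½^n≤1 n)) ⟩
    ½ * 1# + ½ * 1#                         ≈⟨ +-cong (*-identityʳ ½) (*-identityʳ ½) ⟩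
    ½ + ½                                   ≈⟨ ½+½≈1 ⟩
    1#                                      ∎

  ½^n-small : ∀ x ε → 0# < ε → ∃[ n ] x * ½ ^ n < ε
  -- Any n > x/ε works: x ½ⁿ = ε (x/ε) ½ⁿ < ε n ½ⁿ ≤ ε.
  ½^n-small x ε 0<ε with archimedean (x * recip ε 0<ε)
  ... | n , x/ε<n = n , (begin-strict
    x * ½ ^ n                        ≈⟨ *-identityʳ _ ⟨
    x * ½ ^ n * 1#                   ≈⟨ *-congˡ (recip-inverseʳ ε 0<ε) ⟨
    x * ½ ^ n * (ε * recip ε 0<ε)    ≈⟨ solve 4 (λ x h e r → x :* h :* (e :* r) := e :* (h :* (x :* r))) refl x (½ ^ n) ε _ ⟩
    ε * (½ ^ n * (x * recip ε 0<ε))  <⟨ *-monoˡ-< ε 0<ε (*-monoˡ-< (½ ^ n) (0<½^ n) x/ε<n) ⟩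
    ε * (½ ^ n * fromℕ n)            ≈⟨ *-congˡ (*-comm _ _) ⟩
    ε * (fromℕ n * ½ ^ n)            ≤⟨ *-monoˡ-≤ ε (<⇒≤ 0<ε) (n*½^n≤1 n) ⟩
    ε * 1#                           ≈⟨ *-identityʳ ε ⟩
    ε                                ∎)

-- Complex moduli, their bounds and geometric convergence

module ComplexExponential {c ℓ₁ ℓ₂ ℓ₃} (R : RealNumbers c ℓ₁ ℓ₂ ℓ₃) where

  open ComplexNumbers R
  module ℝ = OrderedField R
  module ℂᴿ = CommutativeRing +-*-commutativeRing
  open ℝ using (0#; 1#; _≤_; ½) renaming (Carrier to ℝ)
  open ℝ.Solver using (solve; _:=_; _:+_; _:-_; _:*_; :-_; :0)
  open IntegerCoefficients +-*-commutativeRing using () renaming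
    (solve to solveℂ; _:=_ to _⊜_; _:+_ to _⊞_; _:-_ to _⊟_; :-_ to ⊟_; :0 to :0ℂ)
  open Sequences +-*-commutativeRing public

  ∣∣²-cong : ∀ {z w} → z ≈ w → ∣ z ∣² ℝ.≈ ∣ w ∣²
  ∣∣²-cong (p , q) = ℝ.+-cong (ℝ.*-cong p p) (ℝ.*-cong q q)

  ∣∣²-* : ∀ z w → ∣ z * w ∣² ℝ.≈ ∣ z ∣² ℝ.* ∣ w ∣²
  ∣∣²-* (a +i b) (x +i y) = solve 4 (λ a b x y →
    (a :* x :- b :* y) :* (a :* x :- b :* y) :+ (a :* y :+ b :* x) :* (a :* y :+ b :* x) :=
    (a :* a :+ b :* b) :* (x :* x :+ y :* y)) ℝ.refl a b x y

  0≤∣∣² : ∀ z → 0# ≤ ∣ z ∣²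
  0≤∣∣² (a +i b) = ℝ.0≤x+y (ℝ.0≤x*x a) (ℝ.0≤x*x b)

  ∣z∣²≈0⇒z≈0 : ∀ {z} → ∣ z ∣² ℝ.≈ 0# → z ≈ 0ℂ
  ∣z∣²≈0⇒z≈0 eq = ℝ.x²+y²≈0⇒x≈0 eq , ℝ.x²+y²≈0⇒x≈0 (ℝ.trans (ℝ.+-comm _ _) eq)

  -- By stability ∣ w ∣² may be assumed nonzero, hence positive up to double negation. Dividing it
  -- out of ∣ z ∣² ∣ w ∣² = 0 gives z = 0, a contradiction.
  *-cancelˡ-0 : ∀ {z w} → ¬ (z ≈ 0ℂ) → z * w ≈ 0ℂ → w ≈ 0ℂ
  *-cancelˡ-0 {z} {w} z≉0 zw≈0 = ∣z∣²≈0⇒z≈0 (ℝ.≈-stable λ ∣w∣²≉0 →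
    ℝ.0≤∧≉0⇒¬¬0< (0≤∣∣² w) ∣w∣²≉0 λ 0<∣w∣² →
    z≉0 (∣z∣²≈0⇒z≈0 (ℝ.*-cancelˡ-≈ 0<∣w∣² (
      ℝ.trans (ℝ.*-comm _ _) (ℝ.trans (ℝ.sym (∣∣²-* z w)) (ℝ.trans (∣∣²-cong zw≈0)
        (solve 1 (λ x → :0 :* :0 :+ :0 :* :0 := x :* :0) ℝ.refl _)))))))

  conj-cong : ∀ {z w} → z ≈ w → conj z ≈ conj w
  conj-cong (p , q) = p , ℝ.-‿cong q

  conj-+ : ∀ z w → conj (z + w) ≈ conj z + conj w
  conj-+ z w = ℝ.refl , solve 2 (λ b y → :- (b :+ y) := :- b :+ :- y) ℝ.refl (im z) (im w)

  conj-* : ∀ z w → conj (z * w) ≈ conj z * conj w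
  conj-* (a +i b) (x +i y) =
    solve 4 (λ a b x y → a :* x :- b :* y := a :* x :- :- b :* :- y) ℝ.refl a b x y ,
    solve 4 (λ a b x y → :- (a :* y :+ b :* x) := a :* :- y :+ :- b :* x) ℝ.refl a b x y

  conj-involutive : ∀ z → conj (conj z) ≈ z
  conj-involutive z = ℝ.refl , solve 1 (λ b → :- :- b := b) ℝ.refl (im z)

  conj-fromℝ : ∀ x → conj (fromℝ x) ≈ fromℝ x
  conj-fromℝ x = ℝ.refl , solve 0 (:- :0 := :0) ℝ.refl

  conj-isConjugation : IsConjugation +-*-commutativeRing conj
  conj-isConjugation = record
    { conj-cong       = conj-cong
    ; conj-+          = conj-+
    ; conj-*          = conj-*
    ; conj-involutive = conj-involutive
    ; conj-0          = conj-fromℝ 0#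
    ; conj-1          = conj-fromℝ 1#
    }

  module ℂ* = StarAlgebra +-*-commutativeRing conj-isConjugation

  z*conj[z]≈∣z∣² : ∀ z → z * conj z ≈ fromℝ ∣ z ∣²
  z*conj[z]≈∣z∣² (a +i b) =
    solve 2 (λ a b → a :* a :- b :* :- b := a :* a :+ b :* b) ℝ.refl a b ,
    solve 2 (λ a b → a :* :- b :+ b :* a := :0) ℝ.refl a b

  ∣conj∣² : ∀ z → ∣ conj z ∣² ℝ.≈ ∣ z ∣²
  ∣conj∣² (a +i b) = solve 2 (λ a b → a :* a :+ :- b :* :- b := a :* a :+ b :* b) ℝ.refl a b

  ∣fromℝ∣² : ∀ x → ∣ fromℝ x ∣² ℝ.≈ x ℝ.* x
  ∣fromℝ∣² x = solve 1 (λ x → x :* x :+ :0 :* :0 := x :* x) ℝ.refl x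

  fromℝ-cong : ∀ {x y} → x ℝ.≈ y → fromℝ x ≈ fromℝ y
  fromℝ-cong x≈y = x≈y , ℝ.refl

  fromℝ-+ : ∀ x y → fromℝ (x ℝ.+ y) ≈ fromℝ x + fromℝ y
  fromℝ-+ x y = ℝ.refl , ℝ.sym (ℝ.+-identityˡ 0#)

  fromℝ-* : ∀ x y → fromℝ (x ℝ.* y) ≈ fromℝ x * fromℝ y
  fromℝ-* x y =
    solve 2 (λ x y → x :* y := x :* y :- :0 :* :0) ℝ.refl x y ,
    solve 2 (λ x y → :0 := x :* :0 :+ :0 :* y) ℝ.refl x y

  infix 4 ‖_‖≤_

  -- The modulus is compared through squares, so that no square root has to be formed; the sign
  -- condition makes this equivalent to a bound on the modulus itself.
  record ‖_‖≤_ (z : ℂ) (B : ℝ) : Set (ℓ₁ ⊔ ℓ₃) where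
    constructor bounded
    field
      0≤B     : 0# ≤ B
      ∣z∣²≤B² : ∣ z ∣² ≤ B ℝ.* B

  open ‖_‖≤_ public

  ‖‖-resp-≈ : ∀ {z w B} → z ≈ w → ‖ z ‖≤ B → ‖ w ‖≤ B
  ‖‖-resp-≈ z≈w (bounded 0≤B p) =
    bounded 0≤B (ℝ.≤-trans (ℝ.≤-reflexive (ℝ.sym (∣∣²-cong z≈w))) p)

  ‖‖-mono-≤ : ∀ {z B C} → B ≤ C → ‖ z ‖≤ B → ‖ z ‖≤ C
  ‖‖-mono-≤ B≤C (bounded 0≤B p) = bounded 0≤C (ℝ.≤-trans p (ℝ.*-mono-≤ 0≤B 0≤C B≤C B≤C))
    where 0≤C = ℝ.≤-trans 0≤B B≤C

  ‖0‖≤ : ∀ {B} → 0# ≤ B → ‖ 0ℂ ‖≤ B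
  ‖0‖≤ {B} 0≤B = bounded 0≤B
    (ℝ.≤-trans (ℝ.≤-reflexive (solve 0 (:0 :* :0 :+ :0 :* :0 := :0) ℝ.refl)) (ℝ.0≤x*x B))

  ‖fromℝ‖≤ : ∀ {x} → 0# ≤ x → ‖ fromℝ x ‖≤ x
  ‖fromℝ‖≤ {x} 0≤x = bounded 0≤x (ℝ.≤-reflexive (∣fromℝ∣² x))

  ‖neg‖≤ : ∀ {z B} → ‖ z ‖≤ B → ‖ - z ‖≤ B
  ‖neg‖≤ {a +i b} (bounded 0≤B p) = bounded 0≤B (ℝ.≤-trans (ℝ.≤-reflexive
    (solve 2 (λ a b → :- a :* :- a :+ :- b :* :- b := a :* a :+ b :* b) ℝ.refl a b)) p)

  ‖conj‖≤ : ∀ {z B} → ‖ z ‖≤ B → ‖ conj z ‖≤ B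
  ‖conj‖≤ {z} (bounded 0≤B p) = bounded 0≤B (ℝ.≤-trans (ℝ.≤-reflexive (∣conj∣² z)) p)

  ‖*‖≤ : ∀ {z w B C} → ‖ z ‖≤ B → ‖ w ‖≤ C → ‖ z * w ‖≤ B ℝ.* C
  ‖*‖≤ {z} {w} {B} {C} (bounded 0≤B p) (bounded 0≤C q) = bounded (ℝ.0≤x*y 0≤B 0≤C) (begin
    ∣ z * w ∣²                   ≈⟨ ∣∣²-* z w ⟩
    ∣ z ∣² ℝ.* ∣ w ∣²            ≤⟨ ℝ.*-mono-≤ (0≤∣∣² z) (ℝ.0≤x*x C) p q ⟩
    B ℝ.* B ℝ.* (C ℝ.* C)        ≈⟨ solve 2 (λ b c → b :* b :* (c :* c) := b :* c :* (b :* c)) ℝ.refl B C ⟩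
    B ℝ.* C ℝ.* (B ℝ.* C)        ∎)
    where open ℝ.≤-Reasoning

  -- The triangle inequality: by Cauchy–Schwarz, the real part a x + b y of
  -- z · conj w is at most B C.
  ‖+‖≤ : ∀ {z w B C} → ‖ z ‖≤ B → ‖ w ‖≤ C → ‖ z + w ‖≤ B ℝ.+ C
  ‖+‖≤ {z@(a +i b)} {w@(x +i y)} {B} {C} (bounded 0≤B p) (bounded 0≤C q) =
    bounded (ℝ.0≤x+y 0≤B 0≤C) (begin
      ∣ z + w ∣²
        ≈⟨ solve 4 (λ a b x y → (a :+ x) :* (a :+ x) :+ (b :+ y) :* (b :+ y) :=
             a :* a :+ b :* b :+ (x :* x :+ y :* y) :+ (a :* x :+ b :* y :+ (a :* x :+ b :* y))) ℝ.refl a b x y ⟩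
      ∣ z ∣² ℝ.+ ∣ w ∣² ℝ.+ (s ℝ.+ s)
        ≤⟨ ℝ.+-mono-≤ (ℝ.+-mono-≤ p q) (ℝ.+-mono-≤ s≤BC s≤BC) ⟩
      B ℝ.* B ℝ.+ C ℝ.* C ℝ.+ (B ℝ.* C ℝ.+ B ℝ.* C)
        ≈⟨ solve 2 (λ b c → b :* b :+ c :* c :+ (b :* c :+ b :* c) := (b :+ c) :* (b :+ c)) ℝ.refl B C ⟩
      (B ℝ.+ C) ℝ.* (B ℝ.+ C) ∎)
    where
    open ℝ.≤-Reasoning
    s t : ℝ
    s = a ℝ.* x ℝ.+ b ℝ.* y
    t = a ℝ.* y ℝ.- b ℝ.* x

    s≤BC : s ≤ B ℝ.* C
    s≤BC = ℝ.sqrt-mono-≤ (ℝ.0≤x*y 0≤B 0≤C) (begin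
      s ℝ.* s                ≤⟨ ℝ.x≤x+y _ (ℝ.0≤x*x t) ⟩
      s ℝ.* s ℝ.+ t ℝ.* t    ≈⟨ solve 4 (λ a b x y →
        (a :* x :+ b :* y) :* (a :* x :+ b :* y) :+ (a :* y :- b :* x) :* (a :* y :- b :* x) :=
        (a :* a :+ b :* b) :* (x :* x :+ y :* y)) ℝ.refl a b x y ⟩
      ∣ z ∣² ℝ.* ∣ w ∣²      ≤⟨ ℝ.*-mono-≤ (0≤∣∣² z) (ℝ.0≤x*x C) p q ⟩
      B ℝ.* B ℝ.* (C ℝ.* C)  ≈⟨ solve 2 (λ b c → b :* b :* (c :* c) := b :* c :* (b :* c)) ℝ.refl B C ⟩
      B ℝ.* C ℝ.* (B ℝ.* C)  ∎)

  re≤ : ∀ {z B} → ‖ z ‖≤ B → re z ≤ B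
  re≤ (bounded 0≤B p) = ℝ.sqrt-mono-≤ 0≤B (ℝ.≤-trans (ℝ.x≤x+y _ (ℝ.0≤x*x _)) p)

  im≤ : ∀ {z B} → ‖ z ‖≤ B → im z ≤ B
  im≤ (bounded 0≤B p) = ℝ.sqrt-mono-≤ 0≤B
    (ℝ.≤-trans (ℝ.x≤x+y _ (ℝ.0≤x*x _)) (ℝ.≤-trans (ℝ.≤-reflexive (ℝ.+-comm _ _)) p))

  -- A natural number is chosen so that powers can be compared with factorials inside ℕ. The
  -- successor ensures n ≤ (n + 1)² and keeps the bound nonzero.
  ∃‖‖≤fromℕ : ∀ z → ∃[ n ] ‖ z ‖≤ ℝ.fromℕ (suc n)
  ∃‖‖≤fromℕ z with ℝ.archimedean ∣ z ∣²
  ... | n , ∣z∣²<n = n , bounded (ℝ.0≤fromℕ (suc n)) (begin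
    ∣ z ∣²                          <⟨ ∣z∣²<n ⟩
    ℝ.fromℕ n                       ≤⟨ ℝ.fromℕ-mono-≤ (ℕ.≤-trans (ℕ.n≤1+n n) (ℕ.m≤m*n (suc n) (suc n))) ⟩
    ℝ.fromℕ (suc n ℕ.* suc n)       ≈⟨ ℝ.fromℕ-* (suc n) (suc n) ⟩
    ℝ.fromℕ (suc n) ℝ.* ℝ.fromℕ (suc n) ∎)
    where open ℝ.≤-Reasoning

  ≤K½^⇒≤0 : ∀ {x K} → (∀ n → x ≤ K ℝ.* ½ ℝ.^ n) → x ≤ 0#
  ≤K½^⇒≤0 {x} {K} x≤ 0<x = let n , K½^n<x = ℝ.½^n-small K x 0<x in x≤ n K½^n<x

  ‖‖≤K½^⇒≈0 : ∀ {z K} → (∀ n → ‖ z ‖≤ K ℝ.* ½ ℝ.^ n) → z ≈ 0ℂ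
  ‖‖≤K½^⇒≈0 {z} {K} ‖z‖≤ =
    ℝ.≤-antisym (≤K½^⇒≤0 (re≤ ∘ ‖z‖≤)) (-x≤0⇒0≤x (≤K½^⇒≤0 (re≤ ∘ ‖neg‖≤ ∘ ‖z‖≤))) ,
    ℝ.≤-antisym (≤K½^⇒≤0 (im≤ ∘ ‖z‖≤)) (-x≤0⇒0≤x (≤K½^⇒≤0 (im≤ ∘ ‖neg‖≤ ∘ ‖z‖≤)))
    where
    -x≤0⇒0≤x : ∀ {x} → ℝ.- x ≤ 0# → 0# ≤ x
    -x≤0⇒0≤x -x≤0 x<0 = -x≤0 (ℝ.x<0⇒0<-x x<0)

  infix 4 _⇝_

  -- Convergence with a geometric rate and one constant for all n. Combining limits then only
  -- combines constants, with no ε to distribute.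
  _⇝_ : (ℕ → ℂ) → ℂ → Set _
  s ⇝ l = ∃[ K ] ∀ n → ‖ s n - l ‖≤ K ℝ.* ½ ℝ.^ n

  0≤K : ∀ {z : ℕ → ℂ} {K} → (∀ n → ‖ z n ‖≤ K ℝ.* ½ ℝ.^ n) → 0# ≤ K
  0≤K bound = ℝ.≤-trans (0≤B (bound 0)) (ℝ.≤-reflexive (ℝ.*-identityʳ _))

  ⇝-unique : ∀ {s t l l′} → (∀ n → s n ≈ t n) → s ⇝ l → t ⇝ l′ → l ≈ l′
  ⇝-unique {s} {t} {l} {l′} s≈t (K , s⇝l) (L , t⇝l′) = begin
    l             ≈⟨ solveℂ 2 (λ l l′ → l ⊜ l ⊟ l′ ⊞ l′) ℂᴿ.refl l l′ ⟩
    (l - l′) + l′ ≈⟨ ℂᴿ.+-congʳ (‖‖≤K½^⇒≈0 bound) ⟩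
    0ℂ + l′       ≈⟨ ℂᴿ.+-identityˡ l′ ⟩
    l′            ∎
    where
    open SetoidReasoning ℂᴿ.setoid
    bound : ∀ n → ‖ l - l′ ‖≤ (L ℝ.+ K) ℝ.* ½ ℝ.^ n
    bound n = ‖‖-resp-≈
      (ℂᴿ.trans (ℂᴿ.+-congˡ (ℂᴿ.-‿cong (ℂᴿ.+-congʳ (s≈t n))))
        (solveℂ 3 (λ t l l′ → t ⊟ l′ ⊞ ⊟ (t ⊟ l) ⊜ l ⊟ l′)
          ℂᴿ.refl (t n) l l′))
      (‖‖-mono-≤ (ℝ.≤-reflexive (ℝ.sym (ℝ.distribʳ _ L K))) (‖+‖≤ (t⇝l′ n) (‖neg‖≤ (s⇝l n))))

  -- The tail bounds telescope: ½ᵏ = 2 (½ᵏ − ½ᵏ⁺¹).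
  module _ {f : ℕ → ℂ} {K : ℝ} (‖f‖≤ : ∀ (k : ℕ) → ‖ f k ‖≤ K ℝ.* ½ ℝ.^ k) where

    ‖Σ<-Σ<‖≤′ : ∀ {p m} → p ℕ.≤′ m →
      ‖ Σ< f m - Σ< f p ‖≤ (K ℝ.+ K) ℝ.* (½ ℝ.^ p ℝ.- ½ ℝ.^ m)
    ‖Σ<-Σ<‖≤′ {p} ℕ.≤′-refl = ‖‖-resp-≈ (ℂᴿ.sym (ℂᴿ.-‿inverseʳ (Σ< f p)))
      (‖0‖≤ (ℝ.≤-reflexive (solve 2 (λ k h → :0 := (k :+ k) :* (h :- h)) ℝ.refl K (½ ℝ.^ p))))
    ‖Σ<-Σ<‖≤′ {p} (ℕ.≤′-step {m} p≤m) = ‖‖-resp-≈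
      (solveℂ 3 (λ a b x → a ⊟ b ⊞ x ⊜ a ⊞ x ⊟ b) ℂᴿ.refl (Σ< f m) (Σ< f p) (f m))
      (‖‖-mono-≤ (ℝ.≤-reflexive step) (‖+‖≤ (‖Σ<-Σ<‖≤′ p≤m) (‖f‖≤ m)))
      where
      open SetoidReasoning ℝ.setoid
      a b : ℝ
      a = ½ ℝ.^ p
      b = ½ ℝ.^ suc m
      step : (K ℝ.+ K) ℝ.* (½ ℝ.^ p ℝ.- ½ ℝ.^ m) ℝ.+ K ℝ.* ½ ℝ.^ m ℝ.≈ (K ℝ.+ K) ℝ.* (½ ℝ.^ p ℝ.- ½ ℝ.^ suc m)
      step = begin
        (K ℝ.+ K) ℝ.* (a ℝ.- ½ ℝ.^ m) ℝ.+ K ℝ.* ½ ℝ.^ m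
          ≈⟨ ℝ.+-cong (ℝ.*-congˡ (ℝ.+-congˡ (ℝ.-‿cong (ℝ.½^n≈½^[1+n]+½^[1+n] m)))) (ℝ.*-congˡ (ℝ.½^n≈½^[1+n]+½^[1+n] m)) ⟩
        (K ℝ.+ K) ℝ.* (a ℝ.- (b ℝ.+ b)) ℝ.+ K ℝ.* (b ℝ.+ b)
          ≈⟨ solve 3 (λ k a b → (k :+ k) :* (a :- (b :+ b)) :+ k :* (b :+ b) := (k :+ k) :* (a :- b)) ℝ.refl K a b ⟩
        (K ℝ.+ K) ℝ.* (a ℝ.- b) ∎

    ‖Σ<-Σ<‖≤ : ∀ {p m} → p ℕ.≤ m → ‖ Σ< f m - Σ< f p ‖≤ (K ℝ.+ K) ℝ.* ½ ℝ.^ p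
    ‖Σ<-Σ<‖≤ {p} {m} p≤m = ‖‖-mono-≤
      (ℝ.*-monoˡ-≤ (K ℝ.+ K) (ℝ.0≤x+y 0≤K′ 0≤K′) (ℝ.0≤y-x⇒x≤y (ℝ.≤-trans (ℝ.<⇒≤ (ℝ.0<½^ m))
        (ℝ.≤-reflexive (solve 2 (λ a b → b := a :- (a :- b)) ℝ.refl (½ ℝ.^ p) (½ ℝ.^ m))))))
      (‖Σ<-Σ<‖≤′ (ℕ.≤⇒≤′ p≤m))
      where 0≤K′ = 0≤K ‖f‖≤

    ‖Σ<‖≤ : ∀ m → ‖ Σ< f m ‖≤ K ℝ.+ K
    ‖Σ<‖≤ m = ‖‖-resp-≈ (solveℂ 1 (λ x → x ⊟ :0ℂ ⊜ x) ℂᴿ.refl (Σ< f m))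
      (‖‖-mono-≤ (ℝ.≤-reflexive (ℝ.*-identityʳ _)) (‖Σ<-Σ<‖≤ {0} {m} ℕ.z≤n))

-- Passing from n to n + 1 multiplies mⁿ/n! by m/(n + 1), which is at most 1 once n + 1 ≥ m; up to
-- that point the power alone stays below mᵐ.
^-≤-^*! : ∀ m .{{_ : NonZero m}} n → m ℕ.^ n ℕ.≤ m ℕ.^ m ℕ.* n !
^-≤-^*! m zero    = ℕ.≤-trans (ℕ.m^n>0 m m) (ℕ.≤-reflexive (≡.sym (ℕ.*-identityʳ _)))
^-≤-^*! m (suc n) with ℕ.≤-total (suc n) m
... | inj₁ 1+n≤m = ℕ.≤-trans (ℕ.^-monoʳ-≤ m 1+n≤m) (ℕ.m≤m*n _ (suc n !) {{suc n ℕ.!≢0}})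
... | inj₂ m≤1+n = begin
  m ℕ.* m ℕ.^ n                    ≤⟨ ℕ.*-mono-≤ m≤1+n (^-≤-^*! m n) ⟩
  suc n ℕ.* (m ℕ.^ m ℕ.* n !)      ≡⟨ ℕ.*-assoc (suc n) (m ℕ.^ m) (n !) ⟨
  suc n ℕ.* m ℕ.^ m ℕ.* n !        ≡⟨ ≡.cong (ℕ._* n !) (ℕ.*-comm (suc n) (m ℕ.^ m)) ⟩
  m ℕ.^ m ℕ.* suc n ℕ.* n !        ≡⟨ ℕ.*-assoc (m ℕ.^ m) (suc n) (n !) ⟩
  m ℕ.^ m ℕ.* suc n !              ∎
  where open ℕ.≤-Reasoning

-- Terms of the exponential series and their decay

module Exponential {c ℓ₁ ℓ₂ ℓ₃} (R : RealNumbers c ℓ₁ ℓ₂ ℓ₃) where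

  open ComplexNumbers R
  open ComplexExponential R
  open ℝ using (0#; 1#; _≤_; _<_; ½) renaming (Carrier to ℝ)
  open ℝ.Solver using (solve; _:=_; _:+_; _:*_; :0; :1)
  open SemiringMult semiring public using () renaming (_×_ to _×ℂ_)
  open CommutativeSemigroupProperties ℂᴿ.*-commutativeSemigroup using (x∙yz≈y∙xz)

  -- Repeats the local definition in `IsExp`, so that `expTerm` unfolds to the summand used there.
  1/! : ℕ → ℝ
  1/! n = ℝ.1/ (n !) {{n ℕ.!≢0}}

  1/!*!≈1 : ∀ n → 1/! n ℝ.* ℝ.fromℕ (n !) ℝ.≈ 1#
  1/!*!≈1 n = ℝ.1/n*n≈1 (n !) {{n ℕ.!≢0}}

  0<1/! : ∀ n → 0# < 1/! n
  0<1/! n = ℝ.0<1/ (n !) {{n ℕ.!≢0}}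

  1/!-suc : ∀ n → ℝ.fromℕ (suc n) ℝ.* 1/! (suc n) ℝ.≈ 1/! n
  1/!-suc n = ℝ.*-cancelˡ-≈ (ℝ.0<fromℕ (n !) {{n ℕ.!≢0}}) (begin
    ℝ.fromℕ (n !) ℝ.* (ℝ.fromℕ (suc n) ℝ.* 1/! (suc n))
      ≈⟨ solve 3 (λ a b d → a :* (b :* d) := d :* (b :* a)) ℝ.refl _ _ _ ⟩
    1/! (suc n) ℝ.* (ℝ.fromℕ (suc n) ℝ.* ℝ.fromℕ (n !))
      ≈⟨ ℝ.*-congˡ (ℝ.fromℕ-* (suc n) (n !)) ⟨
    1/! (suc n) ℝ.* ℝ.fromℕ (suc n !)
      ≈⟨ 1/!*!≈1 (suc n) ⟩
    1#
      ≈⟨ 1/!*!≈1 n ⟨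
    1/! n ℝ.* ℝ.fromℕ (n !)
      ≈⟨ ℝ.*-comm _ _ ⟩
    ℝ.fromℕ (n !) ℝ.* 1/! n ∎)
    where open SetoidReasoning ℝ.setoid

  expTerm : ℂ → ℕ → ℂ
  expTerm z n = fromℝ (1/! n) * z ^ n

  fromℝ-fromℕ : ∀ n → fromℝ (ℝ.fromℕ n) ≈ n ×ℂ 1ℂ
  fromℝ-fromℕ zero    = ℂᴿ.refl
  fromℝ-fromℕ (suc n) = ℂᴿ.trans (fromℝ-+ 1# (ℝ.fromℕ n)) (ℂᴿ.+-congˡ (fromℝ-fromℕ n))

  expTerm-isExpTerms : ∀ z → IsExpTerms z (expTerm z)
  expTerm-isExpTerms z n = begin
    (suc n ×ℂ 1ℂ) * (fromℝ (1/! (suc n)) * (z * z ^ n))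
      ≈⟨ ℂᴿ.*-congʳ (fromℝ-fromℕ (suc n)) ⟨
    fromℝ (ℝ.fromℕ (suc n)) * (fromℝ (1/! (suc n)) * (z * z ^ n))
      ≈⟨ ℂᴿ.*-assoc _ _ _ ⟨
    fromℝ (ℝ.fromℕ (suc n)) * fromℝ (1/! (suc n)) * (z * z ^ n)
      ≈⟨ ℂᴿ.*-congʳ (fromℝ-* (ℝ.fromℕ (suc n)) (1/! (suc n))) ⟨
    fromℝ (ℝ.fromℕ (suc n) ℝ.* 1/! (suc n)) * (z * z ^ n)
      ≈⟨ ℂᴿ.*-congʳ (fromℝ-cong (1/!-suc n)) ⟩
    fromℝ (1/! n) * (z * z ^ n)
      ≈⟨ x∙yz≈y∙xz (fromℝ (1/! n)) z (z ^ n) ⟩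
    z * expTerm z n ∎
    where
    open SetoidReasoning ℂᴿ.setoid

  expTerm-0 : ∀ z → expTerm z 0 ≈ 1ℂ
  expTerm-0 z = ℂᴿ.trans (ℂᴿ.*-identityʳ _) (fromℝ-cong (ℝ.trans
    (ℝ.sym (ℝ.trans (ℝ.*-congˡ (ℝ.+-identityʳ 1#)) (ℝ.*-identityʳ _))) (1/!*!≈1 0)))

  suc-cancel : ∀ n {z w} → (suc n ×ℂ 1ℂ) * z ≈ (suc n ×ℂ 1ℂ) * w → z ≈ w
  suc-cancel n {z} {w} eq = begin
    z                                           ≈⟨ inverse z ⟨
    fromℝ (ℝ.1/ (suc n)) * ((suc n ×ℂ 1ℂ) * z)  ≈⟨ ℂᴿ.*-congˡ eq ⟩
    fromℝ (ℝ.1/ (suc n)) * ((suc n ×ℂ 1ℂ) * w)  ≈⟨ inverse w ⟩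
    w                                           ∎
    where
    open SetoidReasoning ℂᴿ.setoid
    inverse : ∀ v → fromℝ (ℝ.1/ (suc n)) * ((suc n ×ℂ 1ℂ) * v) ≈ v
    inverse v = begin
      fromℝ (ℝ.1/ (suc n)) * ((suc n ×ℂ 1ℂ) * v)             ≈⟨ ℂᴿ.*-assoc _ _ _ ⟨
      fromℝ (ℝ.1/ (suc n)) * (suc n ×ℂ 1ℂ) * v               ≈⟨ ℂᴿ.*-congʳ (ℂᴿ.*-congˡ (fromℝ-fromℕ (suc n))) ⟨
      fromℝ (ℝ.1/ (suc n)) * fromℝ (ℝ.fromℕ (suc n)) * v     ≈⟨ ℂᴿ.*-congʳ (fromℝ-* _ _) ⟨
      fromℝ (ℝ.1/ (suc n) ℝ.* ℝ.fromℕ (suc n)) * v           ≈⟨ ℂᴿ.*-congʳ (fromℝ-cong (ℝ.1/n*n≈1 (suc n))) ⟩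
      1ℂ * v                                                 ≈⟨ ℂᴿ.*-identityˡ v ⟩
      v                                                      ∎

  isExpTerms-unique : ∀ {z f g} → f 0 ≈ g 0 → IsExpTerms z f → IsExpTerms z g → ∀ n → f n ≈ g n
  isExpTerms-unique f₀≈g₀ fᵉ gᵉ zero    = f₀≈g₀
  isExpTerms-unique f₀≈g₀ fᵉ gᵉ (suc n) = suc-cancel n (ℂᴿ.trans (fᵉ n)
    (ℂᴿ.trans (ℂᴿ.*-congˡ (isExpTerms-unique f₀≈g₀ fᵉ gᵉ n)) (ℂᴿ.sym (gᵉ n))))

  -- The binomial theorem in disguise: both sequences start with 1 and satisfy the recurrence for z
  -- + w, which determines every term because n + 1 is invertible.
  expTerm-+ : ∀ z w n → (expTerm z ⊛ expTerm w) n ≈ expTerm (z + w) n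
  expTerm-+ z w = isExpTerms-unique
    (ℂᴿ.trans (ℂᴿ.+-identityˡ _) (ℂᴿ.trans (ℂᴿ.*-cong (expTerm-0 z) (expTerm-0 w))
      (ℂᴿ.trans (ℂᴿ.*-identityʳ 1ℂ) (ℂᴿ.sym (expTerm-0 (z + w))))))
    (⊛-isExpTerms {x = z} {y = w} {f = expTerm z} {g = expTerm w} (expTerm-isExpTerms z) (expTerm-isExpTerms w))
    (expTerm-isExpTerms (z + w))

  -- This is (4 m)ⁿ (¼)ⁿ = mⁿ. Writing ¼ as ½ · ½ leaves powers of ½ as the only geometric sequence
  -- in use.
  fromℕ-^-¼ : ∀ m n → ℝ.fromℕ ((m ℕ.* 4) ℕ.^ n) ℝ.* (½ ℝ.^ n ℝ.* ½ ℝ.^ n) ℝ.≈ ℝ.fromℕ m ℝ.^ n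
  fromℕ-^-¼ m zero    = solve 0 ((:1 :+ :0) :* (:1 :* :1) := :1) ℝ.refl
  fromℕ-^-¼ m (suc n) = begin
    ℝ.fromℕ (m ℕ.* 4 ℕ.* (m ℕ.* 4) ℕ.^ n) ℝ.* (½ ℝ.* h ℝ.* (½ ℝ.* h))
      ≈⟨ ℝ.*-congʳ (ℝ.trans (ℝ.fromℕ-* (m ℕ.* 4) ((m ℕ.* 4) ℕ.^ n)) (ℝ.*-congʳ (ℝ.fromℕ-* m 4))) ⟩
    ℝ.fromℕ m ℝ.* ℝ.fromℕ 4 ℝ.* ℝ.fromℕ ((m ℕ.* 4) ℕ.^ n) ℝ.* (½ ℝ.* h ℝ.* (½ ℝ.* h))
      ≈⟨ solve 4 (λ m p b h → m :* (:1 :+ (:1 :+ (:1 :+ (:1 :+ :0)))) :* p :* (b :* h :* (b :* h)) :=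
           m :* ((b :+ b) :* (b :+ b) :* (p :* (h :* h)))) ℝ.refl (ℝ.fromℕ m) (ℝ.fromℕ ((m ℕ.* 4) ℕ.^ n)) ½ h ⟩
    ℝ.fromℕ m ℝ.* ((½ ℝ.+ ½) ℝ.* (½ ℝ.+ ½) ℝ.* (ℝ.fromℕ ((m ℕ.* 4) ℕ.^ n) ℝ.* (h ℝ.* h)))
      ≈⟨ ℝ.*-congˡ (ℝ.*-cong (ℝ.*-cong ℝ.½+½≈1 ℝ.½+½≈1) (fromℕ-^-¼ m n)) ⟩
    ℝ.fromℕ m ℝ.* (1# ℝ.* 1# ℝ.* ℝ.fromℕ m ℝ.^ n)
      ≈⟨ ℝ.*-congˡ (ℝ.trans (ℝ.*-congʳ (ℝ.*-identityʳ 1#)) (ℝ.*-identityˡ _)) ⟩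
    ℝ.fromℕ m ℝ.* ℝ.fromℕ m ℝ.^ n ∎
    where
    open SetoidReasoning ℝ.setoid
    h = ½ ℝ.^ n

  ‖^‖≤ : ∀ {z B} n → ‖ z ‖≤ B → ‖ z ^ n ‖≤ B ℝ.^ n
  ‖^‖≤ zero    ‖z‖≤B = ‖fromℝ‖≤ (ℝ.<⇒≤ ℝ.0<1)
  ‖^‖≤ (suc n) ‖z‖≤B = ‖*‖≤ ‖z‖≤B (‖^‖≤ n ‖z‖≤B)

  -- With ∣ z ∣ ≤ m and M = 4 m, the modulus of the n-th term is at most mⁿ/n! = (Mⁿ/n!) ¼ⁿ ≤ Mᴹ ¼ⁿ.
  -- The rate ¼ instead of ½ leaves a factor ½ⁿ to spare for the Cauchy product.
  ∃‖expTerm‖≤¼^ : ∀ z → ∃[ K ] ∀ n → ‖ expTerm z n ‖≤ K ℝ.* (½ ℝ.^ n ℝ.* ½ ℝ.^ n)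
  ∃‖expTerm‖≤¼^ z = ℝ.fromℕ (M ℕ.^ M) , λ n →
    ‖‖-mono-≤ (bound n) (‖*‖≤ (‖fromℝ‖≤ (ℝ.<⇒≤ (0<1/! n))) (‖^‖≤ n (proj₂ (∃‖‖≤fromℕ z))))
    where
    m M : ℕ
    m = suc (proj₁ (∃‖‖≤fromℕ z))
    M = m ℕ.* 4
    open ℝ.≤-Reasoning
    bound : ∀ n → 1/! n ℝ.* ℝ.fromℕ m ℝ.^ n ≤ ℝ.fromℕ (M ℕ.^ M) ℝ.* (½ ℝ.^ n ℝ.* ½ ℝ.^ n)
    bound n = begin
      1/! n ℝ.* ℝ.fromℕ m ℝ.^ n
        ≈⟨ ℝ.*-congˡ (fromℕ-^-¼ m n) ⟨
      1/! n ℝ.* (ℝ.fromℕ (M ℕ.^ n) ℝ.* q)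
        ≈⟨ solve 3 (λ i x q → i :* (x :* q) := i :* q :* x) ℝ.refl (1/! n) (ℝ.fromℕ (M ℕ.^ n)) q ⟩
      1/! n ℝ.* q ℝ.* ℝ.fromℕ (M ℕ.^ n)
        ≤⟨ ℝ.*-monoˡ-≤ (1/! n ℝ.* q) (ℝ.0≤x*y (ℝ.<⇒≤ (0<1/! n)) (ℝ.0≤x*x (½ ℝ.^ n))) (ℝ.fromℕ-mono-≤ (^-≤-^*! M n)) ⟩
      1/! n ℝ.* q ℝ.* ℝ.fromℕ (M ℕ.^ M ℕ.* n !)
        ≈⟨ ℝ.*-congˡ (ℝ.fromℕ-* (M ℕ.^ M) (n !)) ⟩
      1/! n ℝ.* q ℝ.* (ℝ.fromℕ (M ℕ.^ M) ℝ.* ℝ.fromℕ (n !))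
        ≈⟨ solve 4 (λ i q k f → i :* q :* (k :* f) := i :* f :* (k :* q)) ℝ.refl (1/! n) q (ℝ.fromℕ (M ℕ.^ M)) (ℝ.fromℕ (n !)) ⟩
      1/! n ℝ.* ℝ.fromℕ (n !) ℝ.* (ℝ.fromℕ (M ℕ.^ M) ℝ.* q)
        ≈⟨ ℝ.*-congʳ (1/!*!≈1 n) ⟩
      1# ℝ.* (ℝ.fromℕ (M ℕ.^ M) ℝ.* q)
        ≈⟨ ℝ.*-identityˡ _ ⟩
      ℝ.fromℕ (M ℕ.^ M) ℝ.* q ∎
      where q = ½ ℝ.^ n ℝ.* ½ ℝ.^ n

  0≤K¼ : ∀ {z : ℕ → ℂ} {K} → (∀ n → ‖ z n ‖≤ K ℝ.* (½ ℝ.^ n ℝ.* ½ ℝ.^ n)) → 0# ≤ K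
  0≤K¼ {K = K} bound = ℝ.≤-trans (0≤B (bound 0))
    (ℝ.≤-reflexive (solve 1 (λ k → k :* (:1 :* :1) := k) ℝ.refl K))

  ∃‖expTerm‖≤½^ : ∀ z → ∃[ K ] ∀ n → ‖ expTerm z n ‖≤ K ℝ.* ½ ℝ.^ n
  ∃‖expTerm‖≤½^ z = K , λ n → ‖‖-mono-≤
    (ℝ.*-monoˡ-≤ K 0≤K′ (ℝ.≤-trans
      (ℝ.*-monoˡ-≤ (½ ℝ.^ n) (ℝ.<⇒≤ (ℝ.0<½^ n)) (ℝ.½^-antimono-≤ {0} {n} ℕ.z≤n))
      (ℝ.≤-reflexive (ℝ.*-identityʳ (½ ℝ.^ n)))))
    (bound n)
    where
    K = proj₁ (∃‖expTerm‖≤¼^ z)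
    bound = proj₂ (∃‖expTerm‖≤¼^ z)
    0≤K′ : 0# ≤ K
    0≤K′ = 0≤K¼ bound

-- The functional equation and the existence of the exponential

module ExponentialLaws {c ℓ₁ ℓ₂ ℓ₃} (R : RealNumbers c ℓ₁ ℓ₂ ℓ₃) where

  open ComplexNumbers R
  open ComplexExponential R
  open Exponential R
  open ℝ using (0#; 1#; _≤_; _<_; ½) renaming (Carrier to ℝ)
  open ℝ.Solver using (solve; _:=_; _:+_; _:-_; _:*_; :-_; :1)
  open IntegerCoefficients +-*-commutativeRing using () renaming
    (solve to solveℂ; _:=_ to _⊜_; _:+_ to _⊞_; _:-_ to _⊟_; _:*_ to _⊠_; :-_ to ⊟_)

  expSum : ℂ → ℕ → ℂ
  expSum z = Σ< (expTerm z)

  -- Row k of the defect is at most K ¼ᵏ · 2 L ½ⁿ⁻ᵏ. One of the two factors ½ᵏ in ¼ᵏ completes ½ⁿ⁻ᵏ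
  -- to ½ⁿ, and the other keeps the sum over k bounded.
  ‖expSum*expSum-expSum‖≤ : ∀ z w → ∃[ K ] ∀ n → ‖ expSum z n * expSum w n - expSum (z + w) n ‖≤ K ℝ.* ½ ℝ.^ n
  ‖expSum*expSum-expSum‖≤ z w = K₄ , λ n →
    ‖‖-resp-≈
      (ℂᴿ.trans (ℂᴿ.sym (Σ<*Σ<-Σ<⊛ (expTerm z) (expTerm w) n))
        (ℂᴿ.+-congˡ (ℂᴿ.-‿cong (Σ<-cong n (λ {k} _ → expTerm-+ z w k)))))
      (‖‖-mono-≤ (ℝ.≤-reflexive (ℝ.sym (ℝ.distribʳ _ _ _))) (‖Σ<‖≤ (term n) n))
    where
    K L K₂ K₄ : ℝ
    K = proj₁ (∃‖expTerm‖≤¼^ z)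
    L = proj₁ (∃‖expTerm‖≤½^ w)
    K₂ = K ℝ.* (L ℝ.+ L)
    K₄ = K₂ ℝ.+ K₂
    ‖z‖ : ∀ k → ‖ expTerm z k ‖≤ K ℝ.* (½ ℝ.^ k ℝ.* ½ ℝ.^ k)
    ‖z‖ = proj₂ (∃‖expTerm‖≤¼^ z)
    ‖w‖ : ∀ k → ‖ expTerm w k ‖≤ L ℝ.* ½ ℝ.^ k
    ‖w‖ = proj₂ (∃‖expTerm‖≤½^ w)
    0≤L : 0# ≤ L
    0≤L = 0≤K ‖w‖
    0≤K′ : 0# ≤ K
    0≤K′ = 0≤K¼ ‖z‖

    open ℝ.≤-Reasoning
    term : ∀ n k → ‖ expTerm z k * (expSum w n - expSum w (n ∸ k)) ‖≤ K₂ ℝ.* ½ ℝ.^ n ℝ.* ½ ℝ.^ k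
    term n k = ‖‖-mono-≤ bound (‖*‖≤ (‖z‖ k) (‖Σ<-Σ<‖≤ ‖w‖ (ℕ.m∸n≤m n k)))
      where
      a b : ℝ
      a = ½ ℝ.^ k
      b = ½ ℝ.^ (n ∸ k)
      -- Truncated subtraction gives n ≤ k + (n ∸ k) also for k > n, where the bound on the terms is
      -- required as well.
      ab≤ : a ℝ.* b ≤ ½ ℝ.^ n
      ab≤ = ℝ.≤-trans (ℝ.≤-reflexive (ℝ.sym (ℝ.^-homo-* ½ k (n ∸ k)))) (ℝ.½^-antimono-≤ (ℕ.m≤n+m∸n n k))
      bound : K ℝ.* (a ℝ.* a) ℝ.* ((L ℝ.+ L) ℝ.* b) ≤ K₂ ℝ.* ½ ℝ.^ n ℝ.* a
      bound = begin
        K ℝ.* (a ℝ.* a) ℝ.* ((L ℝ.+ L) ℝ.* b)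
          ≈⟨ solve 4 (λ k l a b → k :* (a :* a) :* ((l :+ l) :* b) := k :* (l :+ l) :* a :* (a :* b)) ℝ.refl K L a b ⟩
        K₂ ℝ.* a ℝ.* (a ℝ.* b)
          ≤⟨ ℝ.*-monoˡ-≤ (K₂ ℝ.* a) (ℝ.0≤x*y (ℝ.0≤x*y 0≤K′ (ℝ.0≤x+y 0≤L 0≤L)) (ℝ.<⇒≤ (ℝ.0<½^ k))) ab≤ ⟩
        K₂ ℝ.* a ℝ.* ½ ℝ.^ n
          ≈⟨ solve 3 (λ k a h → k :* a :* h := k :* h :* a) ℝ.refl K₂ a (½ ℝ.^ n) ⟩
        K₂ ℝ.* ½ ℝ.^ n ℝ.* a ∎

  -- The usual proof for a product of limits, with the Cauchy product defect as a third error.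
  -- Partial sums at w are bounded by 2 L throughout, and the limit u by a natural number U.
  expSum-+ : ∀ {z w u v} → expSum z ⇝ u → expSum w ⇝ v → expSum (z + w) ⇝ u * v
  expSum-+ {z} {w} {u} {v} (A , z⇝u) (B , w⇝v) = A ℝ.* (L ℝ.+ L) ℝ.+ U ℝ.* B ℝ.+ D , λ n →
    ‖‖-resp-≈
      (solveℂ 5 (λ s t d u v → (s ⊟ u) ⊠ t ⊞ u ⊠ (t ⊟ v) ⊞ ⊟ (s ⊠ t ⊟ d) ⊜ d ⊟ u ⊠ v) ℂᴿ.refl
        (expSum z n) (expSum w n) (expSum (z + w) n) u v)
      (‖‖-mono-≤
        (ℝ.≤-reflexive (solve 6 (λ a l u b d h →
          a :* h :* (l :+ l) :+ u :* (b :* h) :+ d :* h := (a :* (l :+ l) :+ u :* b :+ d) :* h) ℝ.refl A L U B D (½ ℝ.^ n)))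
        (‖+‖≤ (‖+‖≤ (‖*‖≤ (z⇝u n) (‖Σ<‖≤ ‖w‖ n)) (‖*‖≤ ‖u‖ (w⇝v n))) (‖neg‖≤ (‖D‖ n))))
    where
    U L D : ℝ
    U = ℝ.fromℕ (suc (proj₁ (∃‖‖≤fromℕ u)))
    L = proj₁ (∃‖expTerm‖≤½^ w)
    D = proj₁ (‖expSum*expSum-expSum‖≤ z w)
    ‖u‖ : ‖ u ‖≤ U
    ‖u‖ = proj₂ (∃‖‖≤fromℕ u)
    ‖w‖ : ∀ k → ‖ expTerm w k ‖≤ L ℝ.* ½ ℝ.^ k
    ‖w‖ = proj₂ (∃‖expTerm‖≤½^ w)
    ‖D‖ : ∀ n → ‖ expSum z n * expSum w n - expSum (z + w) n ‖≤ D ℝ.* ½ ℝ.^ n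
    ‖D‖ = proj₂ (‖expSum*expSum-expSum‖≤ z w)

  ‖expSum-expSum‖≤ : ∀ z → ∃[ K ] ∀ {p m} → p ℕ.≤ m → ‖ expSum z m - expSum z p ‖≤ K ℝ.* ½ ℝ.^ p
  ‖expSum-expSum‖≤ z = _ , ‖Σ<-Σ<‖≤ (proj₂ (∃‖expTerm‖≤½^ z))

  -- `IsExp` carries no rate, but for each n it gives some later partial sum within ½ⁿ of the limit;
  -- the tail bound leads from there back to the n-th one.
  isExp⇒⇝ : ∀ {z w} → IsExp z w → expSum z ⇝ w
  isExp⇒⇝ {z} {w} expw = 1# ℝ.+ K , bound
    where
    K = proj₁ (‖expSum-expSum‖≤ z)
    bound : ∀ n → ‖ expSum z n - w ‖≤ (1# ℝ.+ K) ℝ.* ½ ℝ.^ n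
    bound n = ‖‖-resp-≈
      (solveℂ 3 (λ a b d → a ⊟ b ⊞ ⊟ (a ⊟ d) ⊜ d ⊟ b) ℂᴿ.refl (expSum z m) w (expSum z n))
      (‖‖-mono-≤ (ℝ.≤-reflexive (solve 2 (λ k h → h :+ k :* h := (:1 :+ k) :* h) ℝ.refl K (½ ℝ.^ n)))
        (‖+‖≤ near (‖neg‖≤ (proj₂ (‖expSum-expSum‖≤ z) (ℕ.m≤m+n n N)))))
      where
      N = proj₁ (expw (½ ℝ.^ n) (ℝ.0<½^ n))
      m = n ℕ.+ N
      near : ‖ expSum z m - w ‖≤ ½ ℝ.^ n
      near = ‖‖-resp-≈ (ℂᴿ.+-congʳ (∑≈Σ< (expTerm z) m))
        (bounded (ℝ.<⇒≤ (ℝ.0<½^ n)) (ℝ.<⇒≤ (proj₂ (expw (½ ℝ.^ n) (ℝ.0<½^ n)) m (ℕ.m≤n+m N n))))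

  -- `SinZero x` includes a value of e^(ix), so to contradict the minimality of π at x = πk/n that
  -- value must be produced.
  isExp-exists : ∀ z → ∃[ w ] IsExp z w
  isExp-exists z = (proj₁ lim-re +i proj₁ lim-im) , converges
    where
    s : ℕ → ℂ
    s m = expSum z m

    K : ℝ
    K = proj₁ (‖expSum-expSum‖≤ z)

    cauchy : ∀ ε → 0# < ε → ∃[ N ] ∀ m n → N ℕ.≤ m → N ℕ.≤ n → ∃[ B ] (B < ε) × ‖ s m - s n ‖≤ B
    cauchy ε 0<ε = N , λ m n N≤m N≤n → (K ℝ.+ K) ℝ.* ½ ℝ.^ N , proj₂ small ,
      ‖‖-resp-≈ (solveℂ 3 (λ a b d → a ⊟ b ⊞ ⊟ (d ⊟ b) ⊜ a ⊟ d) ℂᴿ.refl (s m) (s N) (s n))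
        (‖‖-mono-≤ (ℝ.≤-reflexive (ℝ.sym (ℝ.distribʳ _ K K)))
          (‖+‖≤ (proj₂ (‖expSum-expSum‖≤ z) N≤m) (‖neg‖≤ (proj₂ (‖expSum-expSum‖≤ z) N≤n))))
      where
      small = ℝ.½^n-small (K ℝ.+ K) ε 0<ε
      N = proj₁ small

    lim-re = ℝ.cauchy-complete (re ∘ s) λ ε 0<ε → proj₁ (cauchy ε 0<ε) , λ m n N≤m N≤n →
      let B , B<ε , ‖‖≤B = proj₂ (cauchy ε 0<ε) m n N≤m N≤n in ℝ.≤-<-trans (re≤ ‖‖≤B) B<ε
    lim-im = ℝ.cauchy-complete (im ∘ s) λ ε 0<ε → proj₁ (cauchy ε 0<ε) , λ m n N≤m N≤n →
      let B , B<ε , ‖‖≤B = proj₂ (cauchy ε 0<ε) m n N≤m N≤n in ℝ.≤-<-trans (im≤ ‖‖≤B) B<ε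

    w : ℂ
    w = proj₁ lim-re +i proj₁ lim-im

    converges : IsExp z w
    converges ε 0<ε = N₁ ℕ.+ N₂ , λ m N≤m → ℝ.<-respˡ-≈
      (∣∣²-cong (ℂᴿ.+-congʳ {x = - w} (ℂᴿ.sym (∑≈Σ< (expTerm z) m))))
      (bound (s m)
        (proj₂ (proj₂ lim-re (ε ℝ.* ½) 0<ε½) m (ℕ.≤-trans (ℕ.m≤m+n N₁ N₂) N≤m))
        (proj₂ (proj₂ lim-im (ε ℝ.* ½) 0<ε½) m (ℕ.≤-trans (ℕ.m≤n+m N₂ N₁) N≤m)))
      where
      -- Both coordinates within ε/2 make the squared modulus less than 2 (ε/2)² = ε²/2 ≤ ε².
      0<ε½ : 0# < ε ℝ.* ½
      0<ε½ = ℝ.0<x*y 0<ε ℝ.0<½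
      N₁ = proj₁ (proj₂ lim-re (ε ℝ.* ½) 0<ε½)
      N₂ = proj₁ (proj₂ lim-im (ε ℝ.* ½) 0<ε½)

      square : ∀ x y → (x ℝ.- y < ε ℝ.* ½) × (y ℝ.- x < ε ℝ.* ½) →
               (x ℝ.- y) ℝ.* (x ℝ.- y) < ε ℝ.* ½ ℝ.* (ε ℝ.* ½)
      square x y (p , q) = ℝ.square-mono-< p
        (ℝ.<-respˡ-≈ (solve 2 (λ x y → y :- x := :- (x :- y)) ℝ.refl x y) q)

      open ℝ.≤-Reasoning
      bound : ∀ v → (re v ℝ.- re w < ε ℝ.* ½) × (re w ℝ.- re v < ε ℝ.* ½) →
              (im v ℝ.- im w < ε ℝ.* ½) × (im w ℝ.- im v < ε ℝ.* ½) → ∣ v - w ∣² < ε ℝ.* ε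
      bound v p q = begin-strict
        ∣ v - w ∣²
          <⟨ ℝ.<-trans (ℝ.+-monoˡ-< _ (square (re v) (re w) p)) (ℝ.+-monoʳ-< _ (square (im v) (im w) q)) ⟩
        ε ℝ.* ½ ℝ.* (ε ℝ.* ½) ℝ.+ ε ℝ.* ½ ℝ.* (ε ℝ.* ½)
          ≈⟨ solve 2 (λ e h → e :* h :* (e :* h) :+ e :* h :* (e :* h) := e :* e :* ((h :+ h) :* h)) ℝ.refl ε ½ ⟩
        ε ℝ.* ε ℝ.* ((½ ℝ.+ ½) ℝ.* ½)
          ≈⟨ ℝ.*-congˡ (ℝ.*-congʳ ℝ.½+½≈1) ⟩
        ε ℝ.* ε ℝ.* (1# ℝ.* ½)
          ≤⟨ ℝ.*-monoˡ-≤ (ε ℝ.* ε) (ℝ.0≤x*x ε) 1*½≤1 ⟩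
        ε ℝ.* ε ℝ.* 1#
          ≈⟨ ℝ.*-identityʳ _ ⟩
        ε ℝ.* ε ∎
        where
        1*½≤1 : 1# ℝ.* ½ ≤ 1#
        1*½≤1 = ℝ.≤-trans (ℝ.≤-reflexive (ℝ.*-comm 1# ½)) (ℝ.½^-antimono-≤ {0} {1} ℕ.z≤n)

-- The exponential on the imaginary axis and roots of unity

module RootsOfUnity {c ℓ₁ ℓ₂ ℓ₃} (R : RealNumbers c ℓ₁ ℓ₂ ℓ₃) where

  open ComplexNumbers R
  open ComplexExponential R
  open Exponential R
  open ExponentialLaws R
  open ℝ using (0#; 1#; _<_) renaming (Carrier to ℝ)
  open ℝ.Solver using (solve; _:=_; _:+_; _:-_; _:*_; :-_; :0; :1)
  open SemiringExp semiring using (^-congˡ)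

  expSum-cong : ∀ {z w} → z ≈ w → ∀ n → expSum z n ≈ expSum w n
  expSum-cong z≈w n = Σ<-cong n λ {k} _ → ℂᴿ.*-congˡ (^-congˡ k z≈w)

  ⇝-respˡ : ∀ {s t l} → (∀ n → s n ≈ t n) → s ⇝ l → t ⇝ l
  ⇝-respˡ s≈t (K , s⇝l) = K , λ n → ‖‖-resp-≈ (ℂᴿ.+-congʳ (s≈t n)) (s⇝l n)

  expSum-unique : ∀ {z z′ w w′} → z ≈ z′ → expSum z ⇝ w → expSum z′ ⇝ w′ → w ≈ w′
  expSum-unique z≈z′ = ⇝-unique (expSum-cong z≈z′)

  expSum-0 : expSum 0ℂ ⇝ 1ℂ
  -- The empty sum misses the limit by 1 = ½⁰, and all later sums equal it; hence the constant 1.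
  expSum-0 = 1# , λ
    { zero    → ‖‖-resp-≈ (ℂᴿ.sym (ℂᴿ.+-identityˡ (- 1ℂ)))
                  (‖‖-mono-≤ (ℝ.≤-reflexive (ℝ.sym (ℝ.*-identityʳ 1#))) (‖neg‖≤ (‖fromℝ‖≤ (ℝ.<⇒≤ ℝ.0<1))))
    ; (suc n) → ‖‖-resp-≈ (ℂᴿ.sym (ℂᴿ.trans (ℂᴿ.+-congʳ (sum≈1 n)) (ℂᴿ.-‿inverseʳ 1ℂ)))
                  (‖0‖≤ (ℝ.0≤x*y (ℝ.<⇒≤ ℝ.0<1) (ℝ.<⇒≤ (ℝ.0<½^ (suc n)))))
    }
    where
    sum≈1 : ∀ n → expSum 0ℂ (suc n) ≈ 1ℂ
    sum≈1 zero    = ℂᴿ.trans (ℂᴿ.+-identityˡ _) (expTerm-0 0ℂ)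
    sum≈1 (suc n) = ℂᴿ.trans
      (ℂᴿ.+-cong (sum≈1 n) (ℂᴿ.trans (ℂᴿ.*-congˡ (ℂᴿ.zeroˡ (0ℂ ^ n))) (ℂᴿ.zeroʳ (fromℝ (1/! (suc n))))))
      (ℂᴿ.+-identityʳ 1ℂ)

  expSum-^ : ∀ {z w} k → expSum z ⇝ w → expSum (fromℝ (ℝ.fromℕ k) * z) ⇝ w ^ k
  expSum-^ {z} zero    z⇝w = ⇝-respˡ (expSum-cong (ℂᴿ.sym (ℂᴿ.zeroˡ z))) expSum-0
  expSum-^ {z} (suc k) z⇝w = ⇝-respˡ
    (expSum-cong (ℂᴿ.sym (ℂᴿ.trans (ℂᴿ.*-congʳ (fromℝ-+ 1# (ℝ.fromℕ k)))
      (ℂᴿ.trans (ℂᴿ.distribʳ z 1ℂ _) (ℂᴿ.+-congʳ (ℂᴿ.*-identityˡ z))))))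
    (expSum-+ z⇝w (expSum-^ k z⇝w))

  conj-expSum : ∀ z n → conj (expSum z n) ≈ expSum (conj z) n
  conj-expSum z zero    = conj-fromℝ 0#
  conj-expSum z (suc n) = ℂᴿ.trans (conj-+ (expSum z n) (expTerm z n))
    (ℂᴿ.+-cong (conj-expSum z n)
      (ℂᴿ.trans (conj-* (fromℝ (1/! n)) (z ^ n)) (ℂᴿ.*-cong (conj-fromℝ (1/! n)) (ℂ*.conj-^ z n))))

  expSum-conj : ∀ {z w} → expSum z ⇝ w → expSum (conj z) ⇝ conj w
  expSum-conj {z} {w} (K , z⇝w) = K , λ n → ‖‖-resp-≈
    (ℂᴿ.trans (conj-+ (expSum z n) (- w)) (ℂᴿ.+-congʳ (conj-expSum z n)))
    (‖conj‖≤ (z⇝w n))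

  -- Conjugation sends e^(ix) to e^(-ix), and their product is e⁰.
  ∣exp𝕚x∣²≈1 : ∀ {x w} → expSum (𝕚 * fromℝ x) ⇝ w → ∣ w ∣² ℝ.≈ 1#
  ∣exp𝕚x∣²≈1 {x} {w} exp = _≈_.re≈ (ℂᴿ.trans (ℂᴿ.sym (z*conj[z]≈∣z∣² w))
    (expSum-unique 𝕚x+conj[𝕚x]≈0 (expSum-+ exp (expSum-conj exp)) expSum-0))
    where
    𝕚x+conj[𝕚x]≈0 : 𝕚 * fromℝ x + conj (𝕚 * fromℝ x) ≈ 0ℂ
    𝕚x+conj[𝕚x]≈0 =
      solve 1 (λ x → :0 :* x :- :1 :* :0 :+ (:0 :* x :- :1 :* :0) := :0) ℝ.refl x ,
      solve 1 (λ x → :0 :* :0 :+ :1 :* x :+ :- (:0 :* :0 :+ :1 :* x) := :0) ℝ.refl x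

  -- With its converse below: on the unit circle v² = 1 means that v is real, which for v = e^(ix)
  -- is the vanishing of sin x. This translates between powers of ω and `IsPi`.
  ∣v∣≈1∧v²≈1⇒im≈0 : ∀ v → ∣ v ∣² ℝ.≈ 1# → v * v ≈ 1ℂ → im v ℝ.≈ 0#
  ∣v∣≈1∧v²≈1⇒im≈0 (a +i b) ∣v∣≈1 (a²-b²≈1 , _) = ℝ.x²+y²≈0⇒x≈0 (begin
    b ℝ.* b ℝ.+ b ℝ.* b
      ≈⟨ solve 2 (λ a b → b :* b :+ b :* b := a :* a :+ b :* b :- (a :* a :- b :* b)) ℝ.refl a b ⟩
    a ℝ.* a ℝ.+ b ℝ.* b ℝ.- (a ℝ.* a ℝ.- b ℝ.* b)
      ≈⟨ ℝ.+-cong ∣v∣≈1 (ℝ.-‿cong a²-b²≈1) ⟩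
    1# ℝ.- 1#
      ≈⟨ ℝ.-‿inverseʳ 1# ⟩
    0# ∎)
    where open SetoidReasoning ℝ.setoid

  ∣v∣≈1∧im≈0⇒v²≈1 : ∀ v → ∣ v ∣² ℝ.≈ 1# → im v ℝ.≈ 0# → v * v ≈ 1ℂ
  ∣v∣≈1∧im≈0⇒v²≈1 (a +i b) ∣v∣≈1 b≈0 =
    (begin
      a ℝ.* a ℝ.- b ℝ.* b
        ≈⟨ solve 2 (λ a b → a :* a :- b :* b := a :* a :+ b :* b :- b :* (b :+ b)) ℝ.refl a b ⟩
      a ℝ.* a ℝ.+ b ℝ.* b ℝ.- b ℝ.* (b ℝ.+ b)
        ≈⟨ ℝ.+-cong ∣v∣≈1 (ℝ.-‿cong (ℝ.*-congʳ b≈0)) ⟩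
      1# ℝ.- 0# ℝ.* (b ℝ.+ b)
        ≈⟨ solve 1 (λ b → :1 :- :0 :* (b :+ b) := :1) ℝ.refl b ⟩
      1# ∎) ,
    (begin
      a ℝ.* b ℝ.+ b ℝ.* a   ≈⟨ ℝ.+-cong (ℝ.*-congˡ b≈0) (ℝ.*-congʳ b≈0) ⟩
      a ℝ.* 0# ℝ.+ 0# ℝ.* a ≈⟨ solve 1 (λ a → a :* :0 :+ :0 :* a := :0) ℝ.refl a ⟩
      0#                    ∎)
    where open SetoidReasoning ℝ.setoid

  module _ (n : ℕ) .{{_ : NonZero n}} {π : ℝ} (isπ : IsPi π)
           {ω : ℂ} (expω : IsExp (𝕚 * fromℝ (ℝ.fromℕ 2 ℝ.* π ℝ.* ℝ.1/ n)) ω) where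

    private
      exp : expSum (𝕚 * fromℝ (ℝ.fromℕ 2 ℝ.* π ℝ.* ℝ.1/ n)) ⇝ ω
      exp = isExp⇒⇝ expω

      double : ∀ k → fromℝ (ℝ.fromℕ k) * (𝕚 * fromℝ (ℝ.fromℕ 2 ℝ.* π ℝ.* ℝ.1/ n)) ≈
               𝕚 * fromℝ (ℝ.fromℕ k ℝ.* ℝ.1/ n ℝ.* π) + 𝕚 * fromℝ (ℝ.fromℕ k ℝ.* ℝ.1/ n ℝ.* π)
      double k =
        solve 3 (λ k p r →
          k :* (:0 :* (:2 :* p :* r) :- :1 :* :0) :- :0 :* (:0 :* :0 :+ :1 :* (:2 :* p :* r)) :=
          :0 :* (k :* r :* p) :- :1 :* :0 :+ (:0 :* (k :* r :* p) :- :1 :* :0))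
          ℝ.refl (ℝ.fromℕ k) π (ℝ.1/ n) ,
        solve 3 (λ k p r →
          k :* (:0 :* :0 :+ :1 :* (:2 :* p :* r)) :+ :0 :* (:0 :* (:2 :* p :* r) :- :1 :* :0) :=
          :0 :* :0 :+ :1 :* (k :* r :* p) :+ (:0 :* :0 :+ :1 :* (k :* r :* p)))
          ℝ.refl (ℝ.fromℕ k) π (ℝ.1/ n)
        where
        :2 : ℝ.Solver.Polynomial 3
        :2 = :1 :+ (:1 :+ :0)

    ∣ω∣²≈1 : ∣ ω ∣² ℝ.≈ 1#
    ∣ω∣²≈1 = ∣exp𝕚x∣²≈1 exp

    ω^k≈v*v : ∀ k {v} → IsExp (𝕚 * fromℝ (ℝ.fromℕ k ℝ.* ℝ.1/ n ℝ.* π)) v → ω ^ k ≈ v * v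
    ω^k≈v*v k expv = expSum-unique (double k) (expSum-^ k exp) (expSum-+ (isExp⇒⇝ expv) (isExp⇒⇝ expv))

    -- e^(iπ) has modulus 1 and imaginary part sin π = 0, so its square is 1.
    ω^n≈1 : ω ^ n ≈ 1ℂ
    ω^n≈1 = let w , expw , im≈0 = proj₁ (proj₂ isπ) in
      ℂᴿ.trans
        (expSum-unique (ℂᴿ.trans (double n) (ℂᴿ.+-cong n/n*π n/n*π)) (expSum-^ n exp)
          (expSum-+ (isExp⇒⇝ expw) (isExp⇒⇝ expw)))
        (∣v∣≈1∧im≈0⇒v²≈1 w (∣exp𝕚x∣²≈1 (isExp⇒⇝ expw)) im≈0)
      where
      n/n*π : 𝕚 * fromℝ (ℝ.fromℕ n ℝ.* ℝ.1/ n ℝ.* π) ≈ 𝕚 * fromℝ π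
      n/n*π = ℂᴿ.*-congˡ {x = 𝕚} (fromℝ-cong (ℝ.trans
        (ℝ.*-congʳ (ℝ.trans (ℝ.*-comm _ _) (ℝ.1/n*n≈1 n))) (ℝ.*-identityˡ π)))

    -- If ω^k = 1 then e^(iπk/n) = ±1, so πk/n is a zero of sine below π.
    ω^k≉1 : ∀ {k} → 0 ℕ.< k → k ℕ.< n → ¬ (ω ^ k ≈ 1ℂ)
    ω^k≉1 {k} 0<k k<n ω^k≈1 = proj₂ (proj₂ isπ) x 0<x x<π (sinZero (isExp-exists (𝕚 * fromℝ x)))
      where
      0<π : 0# < π
      0<π = proj₁ isπ
      x : ℝ
      x = ℝ.fromℕ k ℝ.* ℝ.1/ n ℝ.* π
      sinZero : ∃[ v ] IsExp (𝕚 * fromℝ x) v → SinZero x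
      sinZero (v , expv) = v , expv ,
        ∣v∣≈1∧v²≈1⇒im≈0 v (∣exp𝕚x∣²≈1 (isExp⇒⇝ expv)) (ℂᴿ.trans (ℂᴿ.sym (ω^k≈v*v k expv)) ω^k≈1)
      0<x : 0# < x
      0<x = ℝ.0<x*y (ℝ.0<x*y (ℝ.0<fromℕ k {{ℕ.>-nonZero 0<k}}) (ℝ.0<1/ n)) 0<π
      open ℝ.≤-Reasoning
      x<π : x < π
      x<π = begin-strict
        ℝ.fromℕ k ℝ.* ℝ.1/ n ℝ.* π   ≈⟨ solve 3 (λ k r p → k :* r :* p := p :* (r :* k)) ℝ.refl (ℝ.fromℕ k) (ℝ.1/ n) π ⟩
        π ℝ.* (ℝ.1/ n ℝ.* ℝ.fromℕ k) <⟨ ℝ.*-monoˡ-< π 0<π (ℝ.*-monoˡ-< (ℝ.1/ n) (ℝ.0<1/ n) (ℝ.fromℕ-mono-< k<n)) ⟩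
        π ℝ.* (ℝ.1/ n ℝ.* ℝ.fromℕ n) ≈⟨ ℝ.*-congˡ (ℝ.1/n*n≈1 n) ⟩
        π ℝ.* 1#                     ≈⟨ ℝ.*-identityʳ π ⟩
        π                            ∎

-- From orthogonality relations to mutually unbiased bases

module ComplexBases {c ℓ₁ ℓ₂ ℓ₃} (R : RealNumbers c ℓ₁ ℓ₂ ℓ₃) where

  open ComplexNumbers R
  open Bases R
  open ComplexExponential R
  open Exponential R using (fromℝ-fromℕ; _×ℂ_)
  open RootsOfUnity R
  open ℂ* using (RowsOrthogonal; ColumnsOrthogonal)
  open ℝ using () renaming (Carrier to ℝ)
  open SemiringSum semiring using (sum-cong-≋; *-distribˡ-sum)
  open IntegerCoefficients +-*-commutativeRing using () renaming (solve to solveℂ; _:=_ to _⊜_; _:*_ to _⊠_)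

  isOrthonormalBasis : ∀ {n} {U : Matrix n n} → RowsOrthogonal 1ℂ U → ColumnsOrthogonal 1ℂ U → IsOrthonormalBasis (columns U)
  isOrthonormalBasis {U = U} rows cols =
    ℂ*.columns-independent {U = U} cols , ℂ*.columns-spanning {U = U} rows ,
    λ j k → ℂᴿ.trans (cols j k) (ℂᴿ.*-identityˡ _)

  ∣r*z∣² : ∀ r z → ∣ fromℝ r * z ∣² ℝ.≈ r ℝ.* r ℝ.* ∣ z ∣²
  ∣r*z∣² r z = ℝ.trans (∣∣²-* (fromℝ r) z) (ℝ.*-congʳ (∣fromℝ∣² r))

  ∣z∣≈1⇒z*z̄≈1 : ∀ {z} → ∣ z ∣² ℝ.≈ ℝ.1# → z * conj z ≈ 1ℂ
  ∣z∣≈1⇒z*z̄≈1 {z} eq = ℂᴿ.trans (z*conj[z]≈∣z∣² z) (fromℝ-cong eq)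

  ∣^∣²≈1 : ∀ {z} k → ∣ z ∣² ℝ.≈ ℝ.1# → ∣ z ^ k ∣² ℝ.≈ ℝ.1#
  ∣^∣²≈1 zero    eq = ℝ.trans (∣fromℝ∣² ℝ.1#) (ℝ.*-identityʳ ℝ.1#)
  ∣^∣²≈1 {z} (suc k) eq = ℝ.trans (∣∣²-* z (z ^ k)) (ℝ.trans (ℝ.*-cong eq (∣^∣²≈1 {z} k eq)) (ℝ.*-identityʳ ℝ.1#))

  module _ (n : ℕ) .{{_ : NonZero n}} where

    N≈n : n ×ℂ 1ℂ ≈ fromℝ (ℝ.fromℕ n)
    N≈n = ℂᴿ.sym (fromℝ-fromℕ n)

    N≉0 : ¬ (n ×ℂ 1ℂ ≈ 0ℂ)
    N≉0 N≈0 = ℝ.<-irrefl (_≈_.re≈ (ℂᴿ.trans (ℂᴿ.sym N≈0) N≈n)) (ℝ.0<fromℕ n)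

    module _ {√n : ℝ} (is√n : ℝ.IsPositiveSqrt (ℝ.fromℕ n) √n) where

      r : ℝ
      r = ℝ.recip √n (proj₁ is√n)

      r*r*n≈1 : r ℝ.* r ℝ.* ℝ.fromℕ n ℝ.≈ ℝ.1#
      r*r*n≈1 = begin
        r ℝ.* r ℝ.* ℝ.fromℕ n         ≈⟨ ℝ.*-congˡ (proj₂ is√n) ⟨
        r ℝ.* r ℝ.* (√n ℝ.* √n)       ≈⟨ solve 2 (λ r s → r :* r :* (s :* s) := r :* s :* (r :* s)) ℝ.refl r √n ⟩
        r ℝ.* √n ℝ.* (r ℝ.* √n)       ≈⟨ ℝ.*-cong r*√n≈1 r*√n≈1 ⟩
        ℝ.1# ℝ.* ℝ.1#                 ≈⟨ ℝ.*-identityʳ ℝ.1# ⟩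
        ℝ.1#                          ∎
        where
        open SetoidReasoning ℝ.setoid
        open ℝ.Solver using (solve; _:=_; _:*_)
        r*√n≈1 : r ℝ.* √n ℝ.≈ ℝ.1#
        r*√n≈1 = ℝ.recip-inverseˡ √n (proj₁ is√n)

      r*r≈1/n : r ℝ.* r ℝ.≈ ℝ.1/ n
      r*r≈1/n = ℝ.*-cancelˡ-≈ (ℝ.0<fromℕ n) (ℝ.trans (ℝ.*-comm _ _)
        (ℝ.trans r*r*n≈1 (ℝ.sym (ℝ.trans (ℝ.*-comm _ _) (ℝ.1/n*n≈1 n)))))

      r*r*N≈1 : fromℝ r * fromℝ r * (n ×ℂ 1ℂ) ≈ 1ℂ
      r*r*N≈1 = ℂᴿ.trans (ℂᴿ.*-cong (ℂᴿ.sym (fromℝ-* r r)) N≈n)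
        (ℂᴿ.trans (ℂᴿ.sym (fromℝ-* (r ℝ.* r) (ℝ.fromℕ n))) (fromℝ-cong r*r*n≈1))

      normalised-isOrthonormalBasis : ∀ {U : Matrix n n} → RowsOrthogonal (n ×ℂ 1ℂ) U →
        ColumnsOrthogonal (n ×ℂ 1ℂ) U → IsOrthonormalBasis (columns (r • U))
      normalised-isOrthonormalBasis {U} rows cols = isOrthonormalBasis
        (ℂ*.rows-normalise {U = U} (conj-fromℝ r) r*r*N≈1 rows)
        (ℂ*.columns-normalise {U = U} (conj-fromℝ r) r*r*N≈1 cols)

      -- The inner product of the j-th standard vector with a column is an entry of the matrix, so
      -- unbiasedness amounts to entries of modulus 1/√n.
      identity-unbiased : ∀ {U : Matrix n n} → (∀ j k → ∣ U j k ∣² ℝ.≈ ℝ.1#) →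
        Unbiased (columns (identity n)) (columns (r • U))
      identity-unbiased {U} ∣U∣²≈1 j k = begin
        ∣ ⟨ columns (identity n) j ∣ columns (r • U) k ⟩ ∣²  ≈⟨ ∣∣²-cong inner≈ ⟩
        ∣ fromℝ r * U j k ∣²                                 ≈⟨ ∣r*z∣² r (U j k) ⟩
        r ℝ.* r ℝ.* ∣ U j k ∣²                               ≈⟨ ℝ.*-cong r*r≈1/n (∣U∣²≈1 j k) ⟩
        ℝ.1/ n ℝ.* ℝ.1#                                      ≈⟨ ℝ.*-identityʳ _ ⟩
        ℝ.1/ n                                               ∎
        where
        open SetoidReasoning ℝ.setoid
        inner≈ : ⟨ columns (identity n) j ∣ columns (r • U) k ⟩ ≈ fromℝ r * U j k
        inner≈ = ℂᴿ.trans
          (sum-cong-≋ {n} (λ i → ℂᴿ.*-congʳ (ℂᴿ.trans (ℂ*.conj-δ i j) (ℂ*.δ-comm i j))))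
          (ℂ*.∑-δ j (λ i → fromℝ r * U i k))

      -- Normalising both matrices multiplies squared inner products by r⁴ = 1/n², which turns n
      -- into 1/n.
      normalised-unbiased : ∀ {U V : Matrix n n} →
        (∀ j k → ⟨ columns U j ∣ columns V k ⟩ * conj ⟨ columns U j ∣ columns V k ⟩ ≈ n ×ℂ 1ℂ) →
        Unbiased (columns (r • U)) (columns (r • V))
      normalised-unbiased {U} {V} ∣UV∣²≈N j k = begin
        ∣ ⟨ columns (r • U) j ∣ columns (r • V) k ⟩ ∣²  ≈⟨ ∣∣²-cong inner≈ ⟩
        ∣ fromℝ (r ℝ.* r) * p ∣²                        ≈⟨ ∣r*z∣² (r ℝ.* r) p ⟩
        r ℝ.* r ℝ.* (r ℝ.* r) ℝ.* ∣ p ∣²                ≈⟨ ℝ.*-congˡ ∣p∣²≈n ⟩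
        r ℝ.* r ℝ.* (r ℝ.* r) ℝ.* ℝ.fromℕ n             ≈⟨ ℝ.*-assoc _ _ _ ⟩
        r ℝ.* r ℝ.* (r ℝ.* r ℝ.* ℝ.fromℕ n)             ≈⟨ ℝ.*-cong r*r≈1/n r*r*n≈1 ⟩
        ℝ.1/ n ℝ.* ℝ.1#                                 ≈⟨ ℝ.*-identityʳ _ ⟩
        ℝ.1/ n                                          ∎
        where
        open SetoidReasoning ℝ.setoid
        p : ℂ
        p = ⟨ columns U j ∣ columns V k ⟩
        ∣p∣²≈n : ∣ p ∣² ℝ.≈ ℝ.fromℕ n
        ∣p∣²≈n = _≈_.re≈ (ℂᴿ.trans (ℂᴿ.sym (z*conj[z]≈∣z∣² p)) (ℂᴿ.trans (∣UV∣²≈N j k) N≈n))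
        inner≈ : ⟨ columns (r • U) j ∣ columns (r • V) k ⟩ ≈ fromℝ (r ℝ.* r) * p
        inner≈ = ℂᴿ.trans
          (sum-cong-≋ {n} (λ i → ℂᴿ.trans
            (ℂᴿ.*-congʳ (ℂᴿ.trans (conj-* (fromℝ r) (U i j)) (ℂᴿ.*-congʳ (conj-fromℝ r))))
            (ℂᴿ.trans (solveℂ 3 (λ r u v → r ⊠ u ⊠ (r ⊠ v) ⊜ r ⊠ r ⊠ (u ⊠ v)) ℂᴿ.refl (fromℝ r) (conj (U i j)) (V i k))
              (ℂᴿ.*-congʳ (ℂᴿ.sym (fromℝ-* r r))))))
          (ℂᴿ.sym (*-distribˡ-sum {n} (fromℝ (r ℝ.* r)) _))

proposition8 :
    ∀ {a ℓ₁ ℓ₂ ℓ₃} (R : RealNumbers a ℓ₁ ℓ₂ ℓ₃) →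
    let module ℝ = RealNumbers R
        open ComplexNumbers R
        open Bases R
    in
    (n : ℕ) .{{_ : NonZero n}} → 2 ℕ.≤ n →
    (√n : ℝ.Carrier) (is√n : ℝ.IsPositiveSqrt (ℝ.fromℕ n) √n) →
    (π : ℝ.Carrier) → IsPi π →
    (ω : ℂ) → IsExp (𝕚 * fromℝ (ℝ.fromℕ 2 ℝ.* π ℝ.* ℝ.1/ n)) ω →
    (c : Fin n → ℂ) →
    c (0 mod n) ≈ 1ℂ →
    (∀ j → 1 ℕ.≤ toℕ j → HasModulus (c j) ℝ.1#) →
    circ n c ⊗ circ n c † ≋ ℝ.fromℕ n • identity n →
    MutuallyUnbiasedBases
      (map columns
        ( identity n
        ∷ dft n √n (proj₁ is√n) ω
        ∷ ℝ.recip √n (proj₁ is√n) • circ n c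
        ∷ []))
proposition8 R n _ √n is√n π isπ ω expω c c₀≈1 ∣c∣≈1 CC†≈n =
  ( isOrthonormalBasis {U = identity n} ℂ*.δ-rowsOrthogonal ℂ*.δ-columnsOrthogonal
  All.∷ normalised-isOrthonormalBasis n is√n {U = ω^jk}
          (ℂ*.fourier-rowsOrthogonal *-cancelˡ-0 n ωω̄≈1 ω^n≈1′ ω^k≉1′)
          (ℂ*.fourier-columnsOrthogonal *-cancelˡ-0 n ωω̄≈1 ω^n≈1′ ω^k≉1′)
  All.∷ normalised-isOrthonormalBasis n is√n {U = circ n c}
          CC†≈N (ℂ*.circulant-columnsOrthogonal n c CC†≈N)
  All.∷ All.[] ) ,
  ( (identity-unbiased n is√n {U = ω^jk} (λ j k → ∣^∣²≈1 {ω} (toℕ j ℕ.* toℕ k) ∣ω∣²≈1′)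
      All.∷ identity-unbiased n is√n {U = circ n c} (λ j k → ∣c∣²≈1 (reflect n (toℕ k) j)) All.∷ All.[])
  AllPairs.∷ (normalised-unbiased n is√n {U = ω^jk} {V = circ n c}
      (ℂ*.∣inner∣²≈N *-cancelˡ-0 n ωω̄≈1 ω^n≈1′ (N≉0 n) {v = c} CC†≈N) All.∷ All.[])
  AllPairs.∷ All.[]
  AllPairs.∷ AllPairs.[] )
  where
  open ComplexNumbers R
  open Bases R
  open ComplexExponential R
  open Exponential R using (_×ℂ_)
  open RootsOfUnity R
  open ComplexBases R

  ω^jk : Matrix n n
  ω^jk j k = ω ^ (toℕ j ℕ.* toℕ k)

  ∣ω∣²≈1′ : ∣ ω ∣² ℝ.≈ ℝ.1#
  ∣ω∣²≈1′ = ∣ω∣²≈1 n isπ expω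

  ωω̄≈1 : ω * conj ω ≈ 1ℂ
  ωω̄≈1 = ∣z∣≈1⇒z*z̄≈1 ∣ω∣²≈1′

  ω^n≈1′ : ω ^ n ≈ 1ℂ
  ω^n≈1′ = ω^n≈1 n isπ expω

  ω^k≉1′ : ∀ {k} → 0 ℕ.< k → k ℕ.< n → ¬ (ω ^ k ≈ 1ℂ)
  ω^k≉1′ = ω^k≉1 n isπ expω

  CC†≈N : ℂ*.RowsOrthogonal (n ×ℂ 1ℂ) (circ n c)
  CC†≈N i j = ℂᴿ.trans (CC†≈n i j) (ℂᴿ.*-congʳ (ℂᴿ.sym (N≈n n)))

  -- The entry at 0 is given by an equation and the others by their moduli, so the index has to be
  -- identified with `0 mod n` when its value is 0.
  ∣c∣²≈1 : ∀ j → ∣ c j ∣² ℝ.≈ ℝ.1#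
  ∣c∣²≈1 j with toℕ j in toℕj≡
  ... | zero  = ℝ.trans (∣∣²-cong (ℂᴿ.trans (ℂᴿ.reflexive (≡.cong c j≡0)) c₀≈1))
                  (ℝ.trans (∣fromℝ∣² ℝ.1#) (ℝ.*-identityʳ ℝ.1#))
    where
    j≡0 : j ≡ 0 mod n
    j≡0 = Fin.toℕ-injective (≡.trans toℕj≡ (≡.sym (≡.trans (toℕ-mod n 0) (m<n⇒m%n≡m (ℕ.>-nonZero⁻¹ n)))))
  ... | suc m = ℝ.trans (ℝ.sym (proj₂ (∣c∣≈1 j (≡.subst (1 ℕ.≤_) (≡.sym toℕj≡) (ℕ.s≤s ℕ.z≤n))))) (ℝ.*-identityʳ ℝ.1#)
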